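{- For every positive integer $n$, $$a(n)=\sum_{r=1}^\infty(-1)^{T_{r-1}}\,T_{\lceil r/2\rceil}\,\mathrm{pod}\left(n-T_{r+1}\right).$$
   Context: For a positive integer $n$, $a(n)$ is the signed number of partitions of $n$ into exactly two distinct part sizes, each occurring an odd number of times: $$a(n)=\sum (-1)^{r_1+r_2},$$ the sum being over all quadruples of integers $(x,y,r_1,r_2)$ with $1\le x<y$, $r_1,r_2\ge 0$ and $(2r_1+1)x+(2r_2+1)y=n$. $T_n=n(n+1)/2$ denotes the $n$-th triangular number. For $n\ge0$, $\mathrm{pod}(n)$ is the number of partitions of $n$ in which odd parts are distinct (even parts are unrestricted), so $\mathrm{pod}(0)=1$; and $\mathrm{pod}(m)=0$ for $m<0$, so the sum is finite. -}

module Defs where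

open import Data.Nat.Base using (ℕ; zero; suc; _+_; _*_; _∸_; _/_; _≤_; _<_; _≥_; z≤n; s≤s; s≤s⁻¹)
import Data.Nat.Properties as ℕ
open import Data.Nat.DivMod using (m/n*n≤m; m*n/n≡m; /-mono-≤)
open import Data.Nat.ListAction using (sum)
open import Data.Nat.Divisibility using (_∣_; _∣?_)
open import Data.Integer.Base as ℤ using (ℤ; +_; -[1+_]; 0ℤ; -1ℤ)
open import Data.List.Base using (List; []; _∷_; _++_; map; concat; filter; foldr; length; replicate; upTo; cartesianProduct)
open import Data.List.Properties using (++-cancelˡ; ∷-injectiveʳ)
open import Data.List.Membership.Propositional using (_∈_)
open import Data.List.Membership.Propositional.Properties using (∈-concat⁺′; ∈-concat⁻′; ∈-map⁺; ∈-map⁻; ∈-upTo⁺; ∈-upTo⁻; ∈-cartesianProduct⁺)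
open import Data.List.Relation.Unary.All as All using (All; []; _∷_)
import Data.List.Relation.Unary.All.Properties as All
open import Data.List.Relation.Unary.Any using (here)
open import Data.List.Relation.Unary.AllPairs as AllPairs using (AllPairs; []; _∷_)
import Data.List.Relation.Unary.AllPairs.Properties as AllPairs
open import Data.List.Relation.Unary.Linked using (Linked)
open import Data.List.Relation.Unary.Linked.Properties using (Linked⇒AllPairs; AllPairs⇒Linked)
open import Data.List.Relation.Unary.Unique.Propositional using (Unique)
import Data.List.Relation.Unary.Unique.Propositional.Properties as Unique
open import Data.List.Relation.Unary.Unique.DecPropositional ℕ._≟_ using (unique?)
open import Data.Product.Base using (_×_; _,_; proj₁; proj₂; ∃; ∃₂)
open import Data.Sum.Base using (inj₁; inj₂)
open import Relation.Nullary using (¬_; Dec; ¬?; contradiction; _×-dec_)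
open import Relation.Binary.PropositionalEquality using (_≡_; refl; sym; trans; cong; subst)

sumℤ : List ℤ → ℤ
sumℤ = foldr ℤ._+_ 0ℤ

Σ[1≤r≤_] : ℕ → (ℕ → ℤ) → ℤ
Σ[1≤r≤ M ] f = sumℤ (map (λ i → f (suc i)) (upTo M))

-- "Σ_{r=1}^∞ f r = s" for a series of integers: the partial sums are eventually equal to s.
Σ[1≤r<∞]_≐_ : (ℕ → ℤ) → ℤ → Set
Σ[1≤r<∞] f ≐ s = ∃ λ N → ∀ M → N ≤ M → Σ[1≤r≤ M ] f ≡ s

T : ℕ → ℕ
T n = n * (n + 1) / 2

Quadruple : Set
Quadruple = ℕ × ℕ × ℕ × ℕ

Admissible : ℕ → Quadruple → Set
Admissible n (x , y , r₁ , r₂) =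
  1 ≤ x × x < y × (2 * r₁ + 1) * x + (2 * r₂ + 1) * y ≡ n

admissible? : ∀ n q → Dec (Admissible n q)
admissible? n (x , y , r₁ , r₂) =
  (1 ℕ.≤? x) ×-dec (x ℕ.<? y) ×-dec ((2 * r₁ + 1) * x + (2 * r₂ + 1) * y ℕ.≟ n)

-- {0,…,n}⁴, which contains every admissible quadruple (admissible⇒∈box),
-- without repetition (box-unique).
box : ℕ → List Quadruple
box n = cartesianProduct I (cartesianProduct I (cartesianProduct I I))
  where I = upTo (suc n)

sign : Quadruple → ℤ
sign (x , y , r₁ , r₂) = -1ℤ ℤ.^ (r₁ + r₂)

a : ℕ → ℤ
a n = sumℤ (map sign (filter (admissible? n) (box n)))

record IsPartition (n : ℕ) (parts : List ℕ) : Set where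
  constructor mkIsPartition
  field
    decreasing : Linked _≥_ parts
    positive   : All (1 ≤_) parts
    sum≡       : sum parts ≡ n

Odd : ℕ → Set
Odd m = ¬ 2 ∣ m

odd? : ∀ m → Dec (Odd m)
odd? m = ¬? (2 ∣? m)

OddPartsDistinct : List ℕ → Set
OddPartsDistinct parts = Unique (filter odd? parts)

oddPartsDistinct? : ∀ parts → Dec (OddPartsDistinct parts)
oddPartsDistinct? parts = unique? (filter odd? parts)

-- Partitions of n into parts of size at most k, generated by choosing the
-- multiplicity j of the part k first.
partitions≤ : ℕ → ℕ → List (List ℕ)
partitions≤ zero    zero    = [] ∷ []
partitions≤ zero    (suc n) = []
partitions≤ (suc k) n       =
  concat (map (λ j → map (replicate j (suc k) ++_) (partitions≤ k (n ∸ j * suc k)))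
              (upTo (suc (n / suc k))))

-- Lists every partition of n exactly once: see partitions-sound,
-- partitions-complete and partitions-unique.
partitions : ℕ → List (List ℕ)
partitions n = partitions≤ n n

pod : ℕ → ℕ
pod n = length (filter oddPartsDistinct? (partitions n))

podℤ : ℤ → ℕ
podℤ (+ n)    = pod n
podℤ -[1+ n ] = 0

private
  m≤[2r+1]*m : ∀ r m → m ≤ (2 * r + 1) * m
  m≤[2r+1]*m r m = ℕ.≤-trans (ℕ.≤-reflexive (sym (ℕ.*-identityˡ m))) (ℕ.*-monoˡ-≤ m (ℕ.m≤n+m 1 (2 * r)))

  r≤[2r+1]*m : ∀ r m → 1 ≤ m → r ≤ (2 * r + 1) * m
  r≤[2r+1]*m r m 1≤m = ℕ.≤-trans (ℕ.≤-trans (ℕ.m≤n*m r 2) (ℕ.m≤m+n (2 * r) 1))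
    (ℕ.≤-trans (ℕ.≤-reflexive (sym (ℕ.*-identityʳ _))) (ℕ.*-monoʳ-≤ (2 * r + 1) 1≤m))

admissible⇒∈box : ∀ n q → Admissible n q → q ∈ box n
admissible⇒∈box n (x , y , r₁ , r₂) (1≤x , x<y , refl) =
  ∈-cartesianProduct⁺ (left (m≤[2r+1]*m r₁ x))
    (∈-cartesianProduct⁺ (right (m≤[2r+1]*m r₂ y))
      (∈-cartesianProduct⁺ (left (r≤[2r+1]*m r₁ x 1≤x))
        (right (r≤[2r+1]*m r₂ y (ℕ.≤-trans 1≤x (ℕ.<⇒≤ x<y))))))
  where
  left : ∀ {i} → i ≤ (2 * r₁ + 1) * x → i ∈ upTo (suc n)
  left le = ∈-upTo⁺ (s≤s (ℕ.≤-trans le (ℕ.m≤m+n _ _)))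
  right : ∀ {i} → i ≤ (2 * r₂ + 1) * y → i ∈ upTo (suc n)
  right le = ∈-upTo⁺ (s≤s (ℕ.≤-trans le (ℕ.m≤n+m _ _)))

box-unique : ∀ n → Unique (box n)
box-unique n = Unique.cartesianProduct⁺ I! (Unique.cartesianProduct⁺ I! (Unique.cartesianProduct⁺ I! I!))
  where I! = Unique.upTo⁺ (suc n)

private
  ≥-trans : ∀ {i j k} → i ≥ j → j ≥ k → i ≥ k
  ≥-trans p q = ℕ.≤-trans q p

  sum-replicate++ : ∀ j k ys → sum (replicate j k ++ ys) ≡ j * k + sum ys
  sum-replicate++ zero    k ys = refl
  sum-replicate++ (suc j) k ys =
    trans (cong (λ t → k + t) (sum-replicate++ j k ys)) (sym (ℕ.+-assoc k (j * k) (sum ys)))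

  all-replicate++ : ∀ {P : ℕ → Set} j {k ys} → P k → All P ys → All P (replicate j k ++ ys)
  all-replicate++ zero    pk pys = pys
  all-replicate++ (suc j) pk pys = pk ∷ all-replicate++ j pk pys

  decreasing-replicate++ : ∀ j {k ys} → All (_≤ k) ys → AllPairs _≥_ ys → AllPairs _≥_ (replicate j k ++ ys)
  decreasing-replicate++ zero    ys≤k ys↓ = ys↓
  decreasing-replicate++ (suc j) ys≤k ys↓ =
    all-replicate++ j ℕ.≤-refl ys≤k ∷ decreasing-replicate++ j ys≤k ys↓

  split : ∀ k xs → AllPairs _≥_ xs → All (_≤ suc k) xs →
          ∃₂ λ j ys → xs ≡ replicate j (suc k) ++ ys × AllPairs _≥_ ys × All (_≤ k) ys
  split k []       _          _             = 0 , [] , refl , [] , []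
  split k (x ∷ xs) (x≥ ∷ xs↓) (x≤ ∷ xs≤) with ℕ.m≤n⇒m<n∨m≡n x≤
  ... | inj₁ x<   = 0 , x ∷ xs , refl , x≥ ∷ xs↓ , s≤s⁻¹ x< ∷ All.map (λ z≤x → ℕ.≤-trans z≤x (s≤s⁻¹ x<)) x≥
  ... | inj₂ refl with split k xs xs↓ xs≤
  ...   | j , ys , refl , ys↓ , ys≤ = suc j , ys , refl , ys↓ , ys≤

  replicate-length-unique : ∀ k i j {xs ys} → All (_≤ k) xs → All (_≤ k) ys →
    replicate i (suc k) ++ xs ≡ replicate j (suc k) ++ ys → i ≡ j
  replicate-length-unique k zero    zero    xs≤ ys≤ eq = refl
  replicate-length-unique k zero    (suc j) (x≤ ∷ _) ys≤ refl = contradiction x≤ ℕ.1+n≰n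
  replicate-length-unique k (suc i) zero    xs≤ (y≤ ∷ _) refl = contradiction y≤ ℕ.1+n≰n
  replicate-length-unique k (suc i) (suc j) xs≤ ys≤ eq =
    cong suc (replicate-length-unique k i j xs≤ ys≤ (∷-injectiveʳ eq))

partitions≤-sound : ∀ k n {xs} → xs ∈ partitions≤ k n → IsPartition n xs × All (_≤ k) xs
partitions≤-sound zero    zero (here refl) = mkIsPartition (AllPairs⇒Linked []) [] refl , []
partitions≤-sound (suc k) n xs∈ with ∈-concat⁻′ (map (λ i → map (replicate i (suc k) ++_) (partitions≤ k (n ∸ i * suc k))) (upTo (suc (n / suc k)))) xs∈
... | _ , xs∈b , b∈ with ∈-map⁻ (λ i → map (replicate i (suc k) ++_) (partitions≤ k (n ∸ i * suc k))) {xs = upTo (suc (n / suc k))} b∈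
... | j , j∈ , refl with ∈-map⁻ (replicate j (suc k) ++_) xs∈b
... | ys , ys∈ , refl with partitions≤-sound k (n ∸ j * suc k) ys∈
... | mkIsPartition ys↓ ys>0 ys≡ , ys≤ =
  mkIsPartition
    (AllPairs⇒Linked (decreasing-replicate++ j (All.map ℕ.m≤n⇒m≤1+n ys≤) (Linked⇒AllPairs ≥-trans ys↓)))
    (all-replicate++ j (s≤s z≤n) ys>0)
    (trans (sum-replicate++ j (suc k) ys) (trans (cong (λ t → j * suc k + t) ys≡) (ℕ.m+[n∸m]≡n jk≤n)))
  , all-replicate++ j ℕ.≤-refl (All.map ℕ.m≤n⇒m≤1+n ys≤)
  where
  jk≤n : j * suc k ≤ n
  jk≤n = ℕ.≤-trans (ℕ.*-monoˡ-≤ (suc k) (s≤s⁻¹ (∈-upTo⁻ {suc (n / suc k)} j∈))) (m/n*n≤m n (suc k))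

partitions≤-complete : ∀ k n {xs} → IsPartition n xs → All (_≤ k) xs → xs ∈ partitions≤ k n
partitions≤-complete zero zero    {[]} _ _ = here refl
partitions≤-complete zero (suc n) {[]} (mkIsPartition _ _ ()) _
partitions≤-complete zero n {x ∷ xs} (mkIsPartition _ (x>0 ∷ _) _) (x≤0 ∷ _) =
  contradiction (ℕ.≤-trans x>0 x≤0) λ ()
partitions≤-complete (suc k) n {xs} (mkIsPartition xs↓ xs>0 xs≡) xs≤
  with split k xs (Linked⇒AllPairs ≥-trans xs↓) xs≤
... | j , ys , refl , ys↓ , ys≤ =
  ∈-concat⁺′ (∈-map⁺ _ (partitions≤-complete k (n ∸ j * suc k) ys-partition ys≤))
    (∈-map⁺ _ (∈-upTo⁺ (s≤s j≤n/k)))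
  where
  jk+ys≡n : j * suc k + sum ys ≡ n
  jk+ys≡n = trans (sym (sum-replicate++ j (suc k) ys)) xs≡
  ys-partition : IsPartition (n ∸ j * suc k) ys
  ys-partition = mkIsPartition (AllPairs⇒Linked ys↓) (All.++⁻ʳ (replicate j (suc k)) xs>0)
    (trans (sym (ℕ.m+n∸m≡n (j * suc k) (sum ys))) (cong (_∸ j * suc k) jk+ys≡n))
  j≤n/k : j ≤ n / suc k
  j≤n/k = subst (_≤ n / suc k) (m*n/n≡m j (suc k))
    (/-mono-≤ (subst (j * suc k ≤_) jk+ys≡n (ℕ.m≤m+n _ _)) (ℕ.≤-refl {suc k}))

partitions≤-unique : ∀ k n → Unique (partitions≤ k n)
partitions≤-unique zero    zero    = [] ∷ []
partitions≤-unique zero    (suc n) = []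
partitions≤-unique (suc k) n = Unique.concat⁺
  (All.map⁺ (All.universal (λ j → Unique.map⁺ (λ {xs} {ys} → ++-cancelˡ (replicate j (suc k)) xs ys)
    (partitions≤-unique k (n ∸ j * suc k))) _))
  (AllPairs.map⁺ (AllPairs.map disjoint (Unique.upTo⁺ (suc (n / suc k)))))
  where
  disjoint : ∀ {i j} → ¬ i ≡ j → ∀ {xs} →
    ¬ (xs ∈ map (replicate i (suc k) ++_) (partitions≤ k (n ∸ i * suc k))
     × xs ∈ map (replicate j (suc k) ++_) (partitions≤ k (n ∸ j * suc k)))
  disjoint {i} {j} i≢j (xs∈ , xs∈′) with ∈-map⁻ (replicate i (suc k) ++_) xs∈ | ∈-map⁻ (replicate j (suc k) ++_) xs∈′
  ... | ys , ys∈ , refl | zs , zs∈ , eq = i≢j (replicate-length-unique k i j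
    (proj₂ (partitions≤-sound k _ ys∈)) (proj₂ (partitions≤-sound k _ zs∈)) eq)

private
  all≤sum : ∀ xs → All (_≤ sum xs) xs
  all≤sum []       = []
  all≤sum (x ∷ xs) = ℕ.m≤m+n x (sum xs) ∷ All.map (λ z≤ → ℕ.≤-trans z≤ (ℕ.m≤n+m (sum xs) x)) (all≤sum xs)

partitions-sound : ∀ n {xs} → xs ∈ partitions n → IsPartition n xs
partitions-sound n xs∈ = proj₁ (partitions≤-sound n n xs∈)

partitions-complete : ∀ n {xs} → IsPartition n xs → xs ∈ partitions n
partitions-complete n {xs} p = partitions≤-complete n n p
  (subst (λ t → All (_≤ t) xs) (IsPartition.sum≡ p) (all≤sum xs))

partitions-unique : ∀ n → Unique (partitions n)
partitions-unique n = partitions≤-unique n n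

{-# OPTIONS --safe #-}
-- Let e_2 be the second elementary symmetric function of the series q^x / (1 + q^{2x}), x ≥ 1;
-- it generates a(n).  It is the z²-coefficient of ∏ (1 + z q^x + q^{2x}) / ∏ (1 + q^{2x}).
-- With z = -(ζ + 1/ζ), the Jacobi triple product expands ∏ (1 - q^x)(1 + z q^x + q^{2x}) as
-- Σ_n q^{T_n} V_n(z), where V_{-1} = V_0 = 1 and V_{n+1} = z V_n - V_{n-1}, and
-- ∏ (1 - q^x)^{-1} (1 + q^{2x})^{-1} = ∏ (1 + q^{2x-1}) / (1 - q^{2x}) generates pod(n).
-- The z²-coefficient of V_{r+1} is (-1)^{T_{r-1}} T_{⌈r/2⌉}.
-- To stay finite, the products are cut at x ≤ N: the coefficient of V_n in
-- ∏_{x≤N} (1 + z q^x + q^{2x}) is q^{T_n} times the Gaussian binomial [2N+1 choose N-n], which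
-- agrees with ∏ (1 - q^x)^{-1} modulo q^{N-n+1}.
module Submission where

open import Defs
open import Data.Nat.Base using (ℕ; zero; suc; pred; _+_; _*_; _∸_; _/_; _≤_; _<_; z≤n; s≤s; s≤s⁻¹; ⌈_/2⌉)
import Data.Nat.Properties as ℕ
open import Data.Nat.DivMod using (+-distrib-/-∣ʳ; m*n/n≡m; m<n⇒m/n≡0; m/n≡1+[m∸n]/n)
open import Data.Nat.Divisibility using (_∣_; divides; n∣m*n; ∣m+n∣m⇒∣n; ∣1⇒≡1)
import Data.Nat.Tactic.RingSolver as ℕSolver
open import Data.Integer.Base as ℤ using (ℤ; +_; 0ℤ; 1ℤ; -1ℤ)
import Data.Integer.Properties as ℤ
open import Data.Integer.Tactic.RingSolver using (solve-∀)
open import Algebra.Properties.AbelianGroup ℤ.+-0-abelianGroup using () renaming (∙-cancelʳ to +-cancelʳ)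
open import Algebra.Properties.CommutativeSemigroup ℤ.+-commutativeSemigroup using (interchange)
open import Data.Bool.Base using (true; false; if_then_else_)
open import Data.List.Base using (List; []; _∷_; _++_; map; concat; filter; length; replicate; upTo; applyUpTo; cartesianProduct)
open import Data.List.Properties using (filter-++; filter-accept; filter-reject; length-++; map-++; map-∘)
open import Data.List.Relation.Unary.All as All using (All; []; _∷_)
import Data.List.Relation.Unary.All.Properties as All
open import Data.List.Relation.Unary.AllPairs using (_∷_)
open import Data.List.Relation.Unary.Unique.Propositional using (Unique)
open import Data.Product.Base using (_×_; _,_; proj₁; proj₂; ∃)
open import Data.Sum.Base using (_⊎_; inj₁; inj₂)
open import Function.Base using (_∘_; id)
open import Relation.Nullary using (¬_; Dec; does; yes; no; contradiction; _×-dec_)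
open import Relation.Unary using (Decidable)
open import Relation.Binary.PropositionalEquality using (_≡_; _≗_; refl; sym; trans; cong; cong₂; subst; module ≡-Reasoning)

-- Finite sums

-- No Cauchy product of series occurs. Multiplication by a fixed series is an operator on `Series`,
-- and `IsMultiplier` records that it is linear, commutes with powers of q and respects truncation;
-- this suffices to move it past any factor 1 + s q^k. Nor is anything divided: products to be
-- inverted are put on both sides and cancelled modulo q^M through `factor-cancel`. The variable z
-- does not occur either. A polynomial in z is held by its coordinates in the basis V_n (`layer`),
-- and its z^k-coefficient is the pairing of these coordinates with `chebyshev k` (`theta`).
-- Multiplication by z passes from one side of the pairing to the other by summation by parts. The
-- cut at N = n is harmless in degree n: precision drops to q^{N-k+1} at V_k, but the accompanying
-- factor q^{T_k} with T_k ≥ k restores q^{N+1}.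

∑ : ℕ → (ℕ → ℤ) → ℤ
∑ zero    f = 0ℤ
∑ (suc n) f = f 0 ℤ.+ ∑ n (f ∘ suc)

∑-cong : ∀ n {f g} → (∀ i → i < n → f i ≡ g i) → ∑ n f ≡ ∑ n g
∑-cong zero    f≡g = refl
∑-cong (suc n) f≡g = cong₂ ℤ._+_ (f≡g 0 (s≤s z≤n)) (∑-cong n λ i i<n → f≡g (suc i) (s≤s i<n))

∑-zero : ∀ n {f} → (∀ i → i < n → f i ≡ 0ℤ) → ∑ n f ≡ 0ℤ
∑-zero zero    f≡0 = refl
∑-zero (suc n) f≡0 = cong₂ ℤ._+_ (f≡0 0 (s≤s z≤n)) (∑-zero n λ i i<n → f≡0 (suc i) (s≤s i<n))

∑-last : ∀ n f → ∑ (suc n) f ≡ ∑ n f ℤ.+ f n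
∑-last zero    f = ℤ.+-comm (f 0) 0ℤ
∑-last (suc n) f = trans (cong (λ t → f 0 ℤ.+ t) (∑-last n (f ∘ suc))) (sym (ℤ.+-assoc (f 0) _ _))

∑-distrib-+ : ∀ n f g → ∑ n (λ i → f i ℤ.+ g i) ≡ ∑ n f ℤ.+ ∑ n g
∑-distrib-+ zero    f g = refl
∑-distrib-+ (suc n) f g =
  trans (cong (λ t → f 0 ℤ.+ g 0 ℤ.+ t) (∑-distrib-+ n (f ∘ suc) (g ∘ suc)))
        (interchange (f 0) (g 0) _ _)

*-distribˡ-∑ : ∀ n c f → c ℤ.* ∑ n f ≡ ∑ n (λ i → c ℤ.* f i)
*-distribˡ-∑ zero    c f = ℤ.*-zeroʳ c
*-distribˡ-∑ (suc n) c f =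
  trans (ℤ.*-distribˡ-+ c (f 0) _) (cong (λ t → c ℤ.* f 0 ℤ.+ t) (*-distribˡ-∑ n c (f ∘ suc)))

∑-comm : ∀ m n (f : ℕ → ℕ → ℤ) → ∑ m (λ i → ∑ n (f i)) ≡ ∑ n (λ j → ∑ m (λ i → f i j))
∑-comm zero    n f = sym (∑-zero n λ _ _ → refl)
∑-comm (suc m) n f =
  trans (cong (λ t → ∑ n (f 0) ℤ.+ t) (∑-comm m n (f ∘ suc)))
        (sym (∑-distrib-+ n (f 0) (λ j → ∑ m (λ i → f (suc i) j))))

-- Formal power series

Series : Set
Series = ℕ → ℤ

infixl 6 _⊕_
infixr 7 _·_
infix  4 _≈[_]_

𝟎 : Series
𝟎 _ = 0ℤ

𝟏 : Series
𝟏 zero    = 1ℤ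
𝟏 (suc _) = 0ℤ

_⊕_ : Series → Series → Series
(f ⊕ g) m = f m ℤ.+ g m

_·_ : ℤ → Series → Series
(c · f) m = c ℤ.* f m

-- Multiplication by q^k.
shift : ℕ → Series → Series
shift zero    f m       = f m
shift (suc k) f zero    = 0ℤ
shift (suc k) f (suc m) = shift k f m

-- Congruence modulo q^M.
_≈[_]_ : Series → ℕ → Series → Set
f ≈[ M ] g = ∀ {m} → m < M → f m ≡ g m

shift-+ : ∀ j k f → shift j (shift k f) ≗ shift (j + k) f
shift-+ zero    k f m       = refl
shift-+ (suc j) k f zero    = refl
shift-+ (suc j) k f (suc m) = shift-+ j k f m

shift-< : ∀ k f {m} → m < k → shift k f m ≡ 0ℤ
shift-< (suc k) f {zero}  _         = refl
shift-< (suc k) f {suc m} (s≤s m<k) = shift-< k f m<k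

shift-≥ : ∀ k f {m} → k ≤ m → shift k f m ≡ f (m ∸ k)
shift-≥ zero    f         _         = refl
shift-≥ (suc k) f {suc m} (s≤s k≤m) = shift-≥ k f k≤m

shift-≈ : ∀ k {f g} M → f ≈[ M ] g → shift k f ≈[ k + M ] shift k g
shift-≈ zero    M f≈g                m<M       = f≈g m<M
shift-≈ (suc k) M f≈g {zero}         _         = refl
shift-≈ (suc k) M f≈g {suc m}        (s≤s m<M) = shift-≈ k M f≈g m<M

shift-⊕ : ∀ k f g → shift k (f ⊕ g) ≗ shift k f ⊕ shift k g
shift-⊕ zero    f g m       = refl
shift-⊕ (suc k) f g zero    = refl
shift-⊕ (suc k) f g (suc m) = shift-⊕ k f g m

shift-· : ∀ k c f → shift k (c · f) ≗ c · shift k f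
shift-· zero    c f m       = refl
shift-· (suc k) c f zero    = sym (ℤ.*-zeroʳ c)
shift-· (suc k) c f (suc m) = shift-· k c f m

shift-cong : ∀ k {f g} → f ≗ g → shift k f ≗ shift k g
shift-cong k f≗g m = shift-≈ k (suc m) (λ {i} _ → f≗g i) (ℕ.m≤n+m (suc m) k)

shift-𝟎 : ∀ k {f} → f ≗ 𝟎 → shift k f ≗ 𝟎
shift-𝟎 zero    f≗𝟎 m       = f≗𝟎 m
shift-𝟎 (suc k) f≗𝟎 zero    = refl
shift-𝟎 (suc k) f≗𝟎 (suc m) = shift-𝟎 k f≗𝟎 m

shift-exp : ∀ {j k} f → j ≡ k → shift j f ≗ shift k f
shift-exp f refl m = refl

-- The operators on series that act as multiplication by a fixed series.
record IsMultiplier (L : Series → Series) : Set where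
  field
    ≈-cong     : ∀ {f g} M → f ≈[ M ] g → L f ≈[ M ] L g
    ⊕-homo     : ∀ f g → L (f ⊕ g) ≗ L f ⊕ L g
    ·-homo     : ∀ c f → L (c · f) ≗ c · L f
    shift-homo : ∀ k f → L (shift k f) ≗ shift k (L f)

  ≗-cong : ∀ {f g} → f ≗ g → L f ≗ L g
  ≗-cong f≗g m = ≈-cong (suc m) (λ {i} _ → f≗g i) ℕ.≤-refl

  𝟎-homo : ∀ {f} → f ≗ 𝟎 → L f ≗ 𝟎
  𝟎-homo {f} f≗𝟎 m =
    trans (≗-cong (λ i → trans (f≗𝟎 i) (sym (ℤ.*-zeroˡ (f i)))) m) (·-homo 0ℤ f m)

  ∑-homo : ∀ n (f : ℕ → Series) m → L (λ m → ∑ n (λ i → f i m)) m ≡ ∑ n (λ i → L (f i) m)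
  ∑-homo zero    f m = 𝟎-homo (λ _ → refl) m
  ∑-homo (suc n) f m =
    trans (⊕-homo (f 0) (λ m → ∑ n (λ i → f (suc i) m)) m)
          (cong (λ t → L (f 0) m ℤ.+ t) (∑-homo n (f ∘ suc) m))

open IsMultiplier

id-isMultiplier : IsMultiplier id
id-isMultiplier = record
  { ≈-cong = λ _ f≈g → f≈g ; ⊕-homo = λ _ _ _ → refl ; ·-homo = λ _ _ _ → refl ; shift-homo = λ _ _ _ → refl }

𝟎-isMultiplier : IsMultiplier (λ _ → 𝟎)
𝟎-isMultiplier = record
  { ≈-cong = λ _ _ _ → refl ; ⊕-homo = λ _ _ _ → refl
  ; ·-homo = λ c _ _ → sym (ℤ.*-zeroʳ c) ; shift-homo = λ k _ m → sym (shift-𝟎 k (λ _ → refl) m) }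

∘-isMultiplier : ∀ {L L′} → IsMultiplier L → IsMultiplier L′ → IsMultiplier (L ∘ L′)
∘-isMultiplier ℒ ℒ′ = record
  { ≈-cong     = λ M → ≈-cong ℒ M ∘ ≈-cong ℒ′ M
  ; ⊕-homo     = λ f g m → trans (≗-cong ℒ (⊕-homo ℒ′ f g) m) (⊕-homo ℒ _ _ m)
  ; ·-homo     = λ c f m → trans (≗-cong ℒ (·-homo ℒ′ c f) m) (·-homo ℒ c _ m)
  ; shift-homo = λ k f m → trans (≗-cong ℒ (shift-homo ℒ′ k f) m) (shift-homo ℒ k _ m)
  }

⊕-isMultiplier : ∀ {L L′} → IsMultiplier L → IsMultiplier L′ → IsMultiplier (λ f → L f ⊕ L′ f)
⊕-isMultiplier {L} {L′} ℒ ℒ′ = record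
  { ≈-cong     = λ M f≈g m<M → cong₂ ℤ._+_ (≈-cong ℒ M f≈g m<M) (≈-cong ℒ′ M f≈g m<M)
  ; ⊕-homo     = λ f g m → trans (cong₂ ℤ._+_ (⊕-homo ℒ f g m) (⊕-homo ℒ′ f g m)) (interchange (L f m) (L g m) (L′ f m) (L′ g m))
  ; ·-homo     = λ c f m → trans (cong₂ ℤ._+_ (·-homo ℒ c f m) (·-homo ℒ′ c f m)) (sym (ℤ.*-distribˡ-+ c (L f m) (L′ f m)))
  ; shift-homo = λ k f m → trans (cong₂ ℤ._+_ (shift-homo ℒ k f m) (shift-homo ℒ′ k f m)) (sym (shift-⊕ k _ _ m))
  }

·-isMultiplier : ∀ s → IsMultiplier (s ·_)
·-isMultiplier s = record
  { ≈-cong     = λ M f≈g m<M → cong (s ℤ.*_) (f≈g m<M)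
  ; ⊕-homo     = λ f g m → ℤ.*-distribˡ-+ s (f m) (g m)
  ; ·-homo     = λ c f m → swap s c (f m)
  ; shift-homo = λ k f m → sym (shift-· k s f m)
  }
  where
  swap : ∀ a b c → a ℤ.* (b ℤ.* c) ≡ b ℤ.* (a ℤ.* c)
  swap = solve-∀

shift-isMultiplier : ∀ k → IsMultiplier (shift k)
shift-isMultiplier k = record
  { ≈-cong     = λ M f≈g m<M → shift-≈ k M f≈g (ℕ.≤-trans m<M (ℕ.m≤n+m M k))
  ; ⊕-homo     = shift-⊕ k
  ; ·-homo     = shift-· k
  ; shift-homo = λ j f m → trans (shift-+ k j f m) (trans (shift-exp f (ℕ.+-comm k j) m) (sym (shift-+ j k f m)))
  }

factor : ℤ → ℕ → Series → Series
factor s k f = f ⊕ s · shift k f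

factor-isMultiplier : ∀ s k → IsMultiplier (factor s k)
factor-isMultiplier s k =
  ⊕-isMultiplier id-isMultiplier (∘-isMultiplier (·-isMultiplier s) (shift-isMultiplier k))

factor-homo : ∀ {L} → IsMultiplier L → ∀ s k f → L (factor s k f) ≗ factor s k (L f)
factor-homo {L} ℒ s k f m = trans (⊕-homo ℒ f (s · shift k f) m)
  (cong (λ t → L f m ℤ.+ t) (trans (·-homo ℒ s (shift k f) m) (cong (s ℤ.*_) (shift-homo ℒ k f m))))

factor-≈ : ∀ s k f → factor s k f ≈[ k ] f
factor-≈ s k f {m} m<k = begin
  f m ℤ.+ s ℤ.* shift k f m  ≡⟨ cong (λ t → f m ℤ.+ s ℤ.* t) (shift-< k f m<k) ⟩
  f m ℤ.+ s ℤ.* 0ℤ           ≡⟨ cong (λ t → f m ℤ.+ t) (ℤ.*-zeroʳ s) ⟩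
  f m ℤ.+ 0ℤ                 ≡⟨ ℤ.+-identityʳ (f m) ⟩
  f m                        ∎
  where open ≡-Reasoning

-- Triangularity: the exponent `suc k` is positive, so in degree m the shifted term reads only
-- coefficients below m, where `f` and `g` agree by induction on `M`.
factor-cancel : ∀ s k {f g} M → factor s (suc k) f ≈[ M ] factor s (suc k) g → f ≈[ M ] g
factor-cancel s k {f} {g} (suc M) eq {m} m<1+M with ℕ.m≤n⇒m<n∨m≡n (s≤s⁻¹ m<1+M)
... | inj₁ m<M  = factor-cancel s k {f} {g} M (λ m<M → eq (ℕ.m<n⇒m<1+n m<M)) m<M
... | inj₂ refl = +-cancelʳ (s ℤ.* shift (suc k) f m) (f m) (g m) (trans (eq ℕ.≤-refl)
  (cong (λ t → g m ℤ.+ s ℤ.* t) (sym (shift-≈ (suc k) {f} {g} m (factor-cancel s k {f} {g} m (λ i<m → eq (ℕ.m<n⇒m<1+n i<m))) (s≤s (ℕ.m≤n+m m k))))))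

1+q^ 1-q^ : ℕ → Series → Series
1+q^ k = factor 1ℤ k
1-q^ k = factor -1ℤ k

∏ : (ℕ → Series → Series) → ℕ → Series → Series
∏ Φ zero    f = f
∏ Φ (suc n) f = Φ (suc n) (∏ Φ n f)

∏-isMultiplier : ∀ {Φ} → (∀ x → IsMultiplier (Φ x)) → ∀ n → IsMultiplier (∏ Φ n)
∏-isMultiplier Φ-mult zero    = id-isMultiplier
∏-isMultiplier Φ-mult (suc n) = ∘-isMultiplier (Φ-mult (suc n)) (∏-isMultiplier Φ-mult n)

-- Gaussian binomials

-- gauss a b is the Gaussian binomial [a-1+b choose b], which is 0 for a = 0.
gauss : ℕ → ℕ → Series → Series
gauss zero    b       f = 𝟎
gauss (suc a) zero    f = f
gauss (suc a) (suc b) f = gauss a (suc b) f ⊕ shift a (gauss (suc a) b f)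

gauss-isMultiplier : ∀ a b → IsMultiplier (gauss a b)
gauss-isMultiplier zero    b       = 𝟎-isMultiplier
gauss-isMultiplier (suc a) zero    = id-isMultiplier
gauss-isMultiplier (suc a) (suc b) = ⊕-isMultiplier (gauss-isMultiplier a (suc b))
  (∘-isMultiplier (shift-isMultiplier a) (gauss-isMultiplier (suc a) b))

-- The dual Pascal rule, with the power of q on the other summand. At (a+1, b+1) it regroups
-- `pascal₂` at (a, b), which in turn calls `pascal` at (a, b+1) and (a+1, b); the mutual recursion
-- ends because a + b decreases.
pascal : ∀ a b f → gauss (suc a) (suc b) f ≗ shift (suc b) (gauss a (suc b) f) ⊕ gauss (suc a) b f
-- The two Pascal rules in succession lower the top index by two. The three summands match the three
-- ways in which a factor 1 + z q^x + q^{2x} contributes to V_n: from V_{n+1}, from V_n and from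
-- V_{n-1}.
pascal₂ : ∀ a b f → gauss (2 + a) (2 + b) f ≗
  shift (2 + b) (gauss a (2 + b) f) ⊕ 1+q^ (2 + a + b) (gauss (suc a) (suc b) f) ⊕ shift (suc a) (gauss (2 + a) b f)

pascal zero    b       f m = cong (ℤ._+ gauss 1 b f m) (sym (shift-𝟎 (suc b) (λ _ → refl) m))
pascal (suc a) zero    f m = begin
  gauss (suc a) 1 f m ℤ.+ shift (suc a) f m                           ≡⟨ cong (ℤ._+ shift (suc a) f m) (pascal a 0 f m) ⟩
  shift 1 (gauss a 1 f) m ℤ.+ f m ℤ.+ shift (suc a) f m               ≡⟨ rotate (shift 1 (gauss a 1 f) m) (f m) _ ⟩
  shift 1 (gauss a 1 f) m ℤ.+ shift (suc a) f m ℤ.+ f m               ≡⟨ cong (λ t → shift 1 (gauss a 1 f) m ℤ.+ t ℤ.+ f m) (shift-+ 1 a f m) ⟨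
  shift 1 (gauss a 1 f) m ℤ.+ shift 1 (shift a f) m ℤ.+ f m           ≡⟨ cong (ℤ._+ f m) (shift-⊕ 1 (gauss a 1 f) (shift a f) m) ⟨
  shift 1 (gauss (suc a) 1 f) m ℤ.+ f m                               ∎
  where
  open ≡-Reasoning
  rotate : ∀ a b c → a ℤ.+ b ℤ.+ c ≡ a ℤ.+ c ℤ.+ b
  rotate = solve-∀
pascal (suc a) (suc b) f m = begin
  gauss (2 + a) (2 + b) f m
    ≡⟨ pascal₂ a b f m ⟩
  x ℤ.+ (y ℤ.+ 1ℤ ℤ.* shift (2 + a + b) (gauss (suc a) (suc b) f) m) ℤ.+ z
    ≡⟨ cong (λ t → x ℤ.+ (y ℤ.+ t) ℤ.+ z) (ℤ.*-identityˡ (shift (2 + a + b) (gauss (suc a) (suc b) f) m)) ⟩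
  x ℤ.+ (y ℤ.+ shift (2 + a + b) (gauss (suc a) (suc b) f) m) ℤ.+ z
    ≡⟨ cong (λ t → x ℤ.+ (y ℤ.+ t) ℤ.+ z) (shift-exp _ (cong (λ t → 2 + t) (ℕ.+-comm a b)) m) ⟩
  x ℤ.+ (y ℤ.+ shift (2 + b + a) (gauss (suc a) (suc b) f) m) ℤ.+ z
    ≡⟨ cong (λ t → x ℤ.+ (y ℤ.+ t) ℤ.+ z) (shift-+ (2 + b) a _ m) ⟨
  x ℤ.+ (y ℤ.+ w) ℤ.+ z
    ≡⟨ regroup x y z w ⟩
  x ℤ.+ w ℤ.+ (y ℤ.+ z)
    ≡⟨ cong (ℤ._+ (y ℤ.+ z)) (shift-⊕ (2 + b) (gauss a (2 + b) f) (shift a (gauss (suc a) (suc b) f)) m) ⟨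
  shift (2 + b) (gauss (suc a) (2 + b) f) m ℤ.+ gauss (2 + a) (suc b) f m
    ∎
  where
  open ≡-Reasoning
  x = shift (2 + b) (gauss a (2 + b) f) m
  y = gauss (suc a) (suc b) f m
  z = shift (suc a) (gauss (2 + a) b f) m
  w = shift (2 + b) (shift a (gauss (suc a) (suc b) f)) m
  regroup : ∀ x y z w → x ℤ.+ (y ℤ.+ w) ℤ.+ z ≡ x ℤ.+ w ℤ.+ (y ℤ.+ z)
  regroup = solve-∀

pascal₂ a b f m = begin
  gauss (suc a) (2 + b) f m ℤ.+ shift (suc a) (gauss (2 + a) (suc b) f) m
    ≡⟨ cong₂ ℤ._+_ (pascal a (suc b) f m) (shift-cong (suc a) (pascal (suc a) b f) m) ⟩
  x ℤ.+ y ℤ.+ shift (suc a) (shift (suc b) (gauss (suc a) (suc b) f) ⊕ gauss (2 + a) b f) m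
    ≡⟨ cong (λ t → x ℤ.+ y ℤ.+ t) (shift-⊕ (suc a) _ _ m) ⟩
  x ℤ.+ y ℤ.+ (shift (suc a) (shift (suc b) (gauss (suc a) (suc b) f)) m ℤ.+ z)
    ≡⟨ cong (λ t → x ℤ.+ y ℤ.+ (t ℤ.+ z)) (trans (shift-+ (suc a) (suc b) _ m) (shift-exp _ (cong suc (ℕ.+-suc a b)) m)) ⟩
  x ℤ.+ y ℤ.+ (w ℤ.+ z)
    ≡⟨ cong (λ t → x ℤ.+ y ℤ.+ (t ℤ.+ z)) (ℤ.*-identityˡ w) ⟨
  x ℤ.+ y ℤ.+ (1ℤ ℤ.* w ℤ.+ z)
    ≡⟨ regroup x y (1ℤ ℤ.* w) z ⟩
  x ℤ.+ (y ℤ.+ 1ℤ ℤ.* w) ℤ.+ z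
    ∎
  where
  open ≡-Reasoning
  x = shift (2 + b) (gauss a (2 + b) f) m
  y = gauss (suc a) (suc b) f m
  z = shift (suc a) (gauss (2 + a) b f) m
  w = shift (2 + a + b) (gauss (suc a) (suc b) f) m
  regroup : ∀ x y w z → x ℤ.+ y ℤ.+ (w ℤ.+ z) ≡ x ℤ.+ (y ℤ.+ w) ℤ.+ z
  regroup = solve-∀

gauss-1 : ∀ b f → gauss 1 b f ≗ f
gauss-1 zero    f m = refl
gauss-1 (suc b) f m = trans (ℤ.+-identityˡ _) (gauss-1 b f m)

-- Symmetry exchanges the defining Pascal rule with its dual `pascal`.
gauss-sym : ∀ a b f → gauss (suc a) b f ≗ gauss (suc b) a f
gauss-sym a       zero    f m = sym (gauss-1 a f m)
gauss-sym zero    (suc b) f m = gauss-1 (suc b) f m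
gauss-sym (suc a) (suc b) f m = begin
  gauss (suc a) (suc b) f m ℤ.+ shift (suc a) (gauss (2 + a) b f) m   ≡⟨ cong₂ ℤ._+_ (gauss-sym a (suc b) f m) (shift-cong (suc a) (gauss-sym (suc a) b f) m) ⟩
  gauss (2 + b) a f m ℤ.+ shift (suc a) (gauss (suc b) (suc a) f) m   ≡⟨ ℤ.+-comm (gauss (2 + b) a f m) _ ⟩
  shift (suc a) (gauss (suc b) (suc a) f) m ℤ.+ gauss (2 + b) a f m   ≡⟨ pascal (suc b) a f m ⟨
  gauss (2 + b) (suc a) f m                                           ∎
  where open ≡-Reasoning

-- The defining Pascal rule minus q^{a+1} times the dual rule pascal.
gauss-absorb : ∀ a b f → 1-q^ (suc a) (gauss (2 + a) b f) ≗ 1-q^ (suc a + b) (gauss (suc a) b f)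
gauss-absorb a zero    f m = cong (λ t → f m ℤ.+ -1ℤ ℤ.* t) (shift-exp f (sym (ℕ.+-identityʳ (suc a))) m)
gauss-absorb a (suc b) f m = begin
  x ℤ.+ y ℤ.+ -1ℤ ℤ.* shift (suc a) (gauss (2 + a) (suc b) f) m
    ≡⟨ cong (λ t → x ℤ.+ y ℤ.+ -1ℤ ℤ.* t) (trans (shift-cong (suc a) (pascal (suc a) b f) m) (shift-⊕ (suc a) _ _ m)) ⟩
  x ℤ.+ y ℤ.+ -1ℤ ℤ.* (shift (suc a) (shift (suc b) (gauss (suc a) (suc b) f)) m ℤ.+ y)
    ≡⟨ cong (λ t → x ℤ.+ y ℤ.+ -1ℤ ℤ.* (t ℤ.+ y)) (shift-+ (suc a) (suc b) _ m) ⟩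
  x ℤ.+ y ℤ.+ -1ℤ ℤ.* (w ℤ.+ y)
    ≡⟨ cancel x y w ⟩
  x ℤ.+ -1ℤ ℤ.* w
    ∎
  where
  open ≡-Reasoning
  x = gauss (suc a) (suc b) f m
  y = shift (suc a) (gauss (2 + a) b f) m
  w = shift (suc a + suc b) (gauss (suc a) (suc b) f) m
  cancel : ∀ x y w → x ℤ.+ y ℤ.+ -1ℤ ℤ.* (w ℤ.+ y) ≡ x ℤ.+ -1ℤ ℤ.* w
  cancel = solve-∀

qfact : ℕ → Series → Series
qfact = ∏ 1-q^

-- By `gauss-absorb`, ∏_{x≤a} (1 - q^x) turns the binomial [a+b choose b] into ∏_{i≤a} (1 -
-- q^{b+i}), whose factors are all 1 modulo q^{b+1}.
gauss-qfact-diagonal : ∀ a b f → gauss (suc a) b (qfact a f) ≈[ suc b ] f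
gauss-qfact-diagonal zero    b f {m} _     = gauss-1 b f m
gauss-qfact-diagonal (suc a) b f {m} m<1+b = begin
  gauss (2 + a) b (1-q^ (suc a) (qfact a f)) m   ≡⟨ factor-homo (gauss-isMultiplier (2 + a) b) -1ℤ (suc a) (qfact a f) m ⟩
  1-q^ (suc a) (gauss (2 + a) b (qfact a f)) m ≡⟨ gauss-absorb a b (qfact a f) m ⟩
  1-q^ (suc a + b) (gauss (suc a) b (qfact a f)) m ≡⟨ factor-≈ -1ℤ (suc a + b) (gauss (suc a) b (qfact a f)) (ℕ.≤-trans m<1+b (s≤s (ℕ.m≤n+m b a))) ⟩
  gauss (suc a) b (qfact a f) m                  ≡⟨ gauss-qfact-diagonal a b f m<1+b ⟩
  f m                                            ∎
  where open ≡-Reasoning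

-- The `d` additional factors 1 - q^x have x > a and are invisible modulo q^{a+1}. They allow one
-- product, of length 2N, to serve all the binomials at once.
gauss-qfact : ∀ a b d f → a ≤ b → gauss (suc a) b (qfact (d + a) f) ≈[ suc a ] f
gauss-qfact a b zero    f a≤b m<1+a = gauss-qfact-diagonal a b f (ℕ.≤-trans m<1+a (s≤s a≤b))
gauss-qfact a b (suc d) f a≤b m<1+a = trans
  (≈-cong (gauss-isMultiplier (suc a) b) {qfact (suc d + a) f} {qfact (d + a) f} (suc a)
    (λ i<1+a → factor-≈ -1ℤ (suc d + a) (qfact (d + a) f) (ℕ.≤-trans i<1+a (s≤s (ℕ.m≤n+m a d)))) m<1+a)
  (gauss-qfact a b d f a≤b m<1+a)

-- Triangular numbers and doubling

T-suc : ∀ n → T (suc n) ≡ suc n + T n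
T-suc n = begin
  suc n * (suc n + 1) / 2             ≡⟨ cong (_/ 2) (expand n) ⟩
  (n * (n + 1) + suc n * 2) / 2       ≡⟨ +-distrib-/-∣ʳ (n * (n + 1)) (n∣m*n (suc n)) ⟩
  n * (n + 1) / 2 + suc n * 2 / 2     ≡⟨ cong (λ t → T n + t) (m*n/n≡m (suc n) 2) ⟩
  T n + suc n                         ≡⟨ ℕ.+-comm (T n) (suc n) ⟩
  suc n + T n                         ∎
  where
  open ≡-Reasoning
  expand : ∀ n → suc n * (suc n + 1) ≡ n * (n + 1) + suc n * 2
  expand = ℕSolver.solve-∀

n≤Tn : ∀ n → n ≤ T n
n≤Tn zero    = z≤n
n≤Tn (suc n) = subst (suc n ≤_) (sym (T-suc n)) (ℕ.m≤m+n (suc n) (T n))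

-- Recursive, unlike `2 * n`, so that `double (suc n)` computes to two successors: parity inductions
-- follow it directly, and `factor-cancel` finds its positive exponent.
double : ℕ → ℕ
double zero    = zero
double (suc n) = suc (suc (double n))

double≡+ : ∀ n → double n ≡ n + n
double≡+ zero    = refl
double≡+ (suc n) = cong suc (trans (cong suc (double≡+ n)) (sym (ℕ.+-suc n n)))

-- A finite Jacobi triple product

-- layer N n is the coefficient of V_n in ∏_{x≤N} (1 + z q^x + q^{2x}), where V_{-1} = V_0 = 1
-- and z V_n = V_{n+1} + V_{n-1}.
layer : ℕ → ℕ → Series → Series
layer zero    zero    f = f
layer zero    (suc n) f = 𝟎
layer (suc N) n       f =
  1+q^ (double (suc N)) (layer N n f) ⊕ shift (suc N) (layer N (pred n) f ⊕ layer N (suc n) f)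

layer-> : ∀ N n f → N < n → layer N n f ≗ 𝟎
layer-> zero    (suc n) f _         m = refl
layer-> (suc N) (suc n) f (s≤s N<n) m = cong₂ ℤ._+_
  (𝟎-homo (factor-isMultiplier 1ℤ (double (suc N))) (layer-> N (suc n) f (ℕ.m<n⇒m<1+n N<n)) m)
  (shift-𝟎 (suc N) (λ i → cong₂ ℤ._+_ (layer-> N n f N<n i)
    (layer-> N (2 + n) f (ℕ.m<n⇒m<1+n (ℕ.m<n⇒m<1+n N<n)) i)) m)

-- The recursion of `layer` is `pascal₂` multiplied by q^{T_n}; the exponents agree because T_{n+1}
-- + N + 1 = T_n + (N + n + 2) and T_{n-1} + N + 1 = T_n + (N - n + 1). The index `a` = N + 1 - n
-- may be 0, where the convention `gauss zero` = 0 matches the vanishing of V_{N+1}'s coefficient.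
layer-gauss : ∀ N n a f → a + n ≡ suc N → layer N n f ≗ shift (T n) (gauss a (suc (N + n)) f)
layer-gauss-pred : ∀ N n a f → a + n ≡ N →
  shift (suc N) (layer N (pred n) f) ≗ shift (T n) (shift (suc a) (gauss (2 + a) (N + n) f))

layer-gauss-pred N zero a f a+0≡N m with refl ← trans (sym (ℕ.+-identityʳ a)) a+0≡N = begin
  shift (suc N) (layer N 0 f) m                       ≡⟨ shift-cong (suc N) (layer-gauss N 0 (suc N) f (ℕ.+-identityʳ (suc N))) m ⟩
  shift (suc N) (gauss (suc N) (suc (N + 0)) f) m     ≡⟨ shift-cong (suc N) (gauss-sym N (suc (N + 0)) f) m ⟩
  shift (suc N) (gauss (2 + (N + 0)) N f) m           ≡⟨ cong (λ t → shift (suc N) (gauss (2 + t) N f) m) (ℕ.+-identityʳ N) ⟩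
  shift (suc N) (gauss (2 + N) N f) m                 ≡⟨ cong (λ t → shift (suc N) (gauss (2 + N) t f) m) (ℕ.+-identityʳ N) ⟨
  shift (suc N) (gauss (2 + N) (N + 0) f) m           ∎
  where open ≡-Reasoning
layer-gauss-pred N (suc n) a f a+n≡N m = begin
  shift (suc N) (layer N n f) m                                         ≡⟨ shift-cong (suc N) (layer-gauss N n (2 + a) f (cong suc (trans (sym (ℕ.+-suc a n)) a+n≡N))) m ⟩
  shift (suc N) (shift (T n) (gauss (2 + a) (suc (N + n)) f)) m         ≡⟨ shift-+ (suc N) (T n) _ m ⟩
  shift (suc N + T n) (gauss (2 + a) (suc (N + n)) f) m                 ≡⟨ shift-exp _ exponents m ⟩
  shift (T (suc n) + suc a) (gauss (2 + a) (suc (N + n)) f) m           ≡⟨ shift-+ (T (suc n)) (suc a) _ m ⟨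
  shift (T (suc n)) (shift (suc a) (gauss (2 + a) (suc (N + n)) f)) m   ≡⟨ cong (λ t → shift (T (suc n)) (shift (suc a) (gauss (2 + a) t f)) m) (ℕ.+-suc N n) ⟨
  shift (T (suc n)) (shift (suc a) (gauss (2 + a) (N + suc n) f)) m     ∎
  where
  open ≡-Reasoning
  regroup : ∀ a n t → suc (a + suc n) + t ≡ suc n + t + suc a
  regroup = ℕSolver.solve-∀
  exponents : suc N + T n ≡ T (suc n) + suc a
  exponents = trans (cong (λ t → suc t + T n) (sym a+n≡N))
    (trans (regroup a n (T n)) (cong (_+ suc a) (sym (T-suc n))))

layer-gauss zero    zero          (suc zero)    f eq m = sym (gauss-1 1 f m)
layer-gauss zero    (suc n)       zero          f eq m = sym (shift-𝟎 (T (suc n)) (λ _ → refl) m)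
layer-gauss zero    (suc n)       (suc a)       f eq m = contradiction (trans (sym (ℕ.+-suc a n)) (ℕ.suc-injective eq)) λ ()
layer-gauss (suc N) n             zero          f refl m =
  trans (layer-> (suc N) (2 + N) f ℕ.≤-refl m) (sym (shift-𝟎 (T (2 + N)) (λ _ → refl) m))
-- The top coefficient, n = N + 1, which `pascal₂` does not reach: only V_N, multiplied by z
-- q^{N+1}, contributes.
layer-gauss (suc N) n             (suc zero)    f refl m = begin
  1+q^ (double (suc N)) (layer N (suc N) f) m ℤ.+ shift (suc N) (layer N N f ⊕ layer N (2 + N) f) m
    ≡⟨ cong₂ ℤ._+_ (𝟎-homo (factor-isMultiplier 1ℤ (double (suc N))) (layer-> N (suc N) f ℕ.≤-refl) m) (shift-⊕ (suc N) _ _ m) ⟩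
  0ℤ ℤ.+ (shift (suc N) (layer N N f) m ℤ.+ shift (suc N) (layer N (2 + N) f) m)
    ≡⟨ ℤ.+-identityˡ _ ⟩
  shift (suc N) (layer N N f) m ℤ.+ shift (suc N) (layer N (2 + N) f) m
    ≡⟨ cong₂ ℤ._+_ (shift-cong (suc N) (layer-gauss N N 1 f refl) m)
         (shift-𝟎 (suc N) (layer-> N (2 + N) f (s≤s (ℕ.n≤1+n N))) m) ⟩
  shift (suc N) (shift (T N) (gauss 1 (suc (N + N)) f)) m ℤ.+ 0ℤ
    ≡⟨ ℤ.+-identityʳ _ ⟩
  shift (suc N) (shift (T N) (gauss 1 (suc (N + N)) f)) m
    ≡⟨ shift-+ (suc N) (T N) _ m ⟩
  shift (suc N + T N) (gauss 1 (suc (N + N)) f) m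
    ≡⟨ shift-exp _ (sym (T-suc N)) m ⟩
  shift (T (suc N)) (gauss 1 (suc (N + N)) f) m
    ≡⟨ shift-cong (T (suc N)) (λ i → trans (gauss-1 (suc (N + N)) f i) (sym (gauss-1 (suc (suc N + suc N)) f i))) m ⟩
  shift (T (suc N)) (gauss 1 (suc (suc N + suc N)) f) m
    ∎
  where open ≡-Reasoning
layer-gauss (suc N) n             (suc (suc a)) f eq m = begin
  1+q^ (double (suc N)) (layer N n f) m ℤ.+ shift (suc N) (layer N (pred n) f ⊕ layer N (suc n) f) m
    ≡⟨ cong₂ ℤ._+_ middle (trans (shift-⊕ (suc N) _ _ m) (cong₂ ℤ._+_ (layer-gauss-pred N n a f a+n≡N m) upper)) ⟩
  y ℤ.+ (z ℤ.+ x)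
    ≡⟨ regroup x y z ⟩
  x ℤ.+ y ℤ.+ z
    ≡⟨ cong (ℤ._+ z) (shift-⊕ (T n) _ _ m) ⟨
  shift (T n) (X ⊕ Y) m ℤ.+ z
    ≡⟨ shift-⊕ (T n) _ _ m ⟨
  shift (T n) (X ⊕ Y ⊕ Z) m
    ≡⟨ shift-cong (T n) (pascal₂ a (N + n) f) m ⟨
  shift (T n) (gauss (2 + a) (2 + (N + n)) f) m
    ∎
  where
  open ≡-Reasoning
  X = shift (2 + (N + n)) (gauss a (2 + (N + n)) f)
  Y = 1+q^ (2 + a + (N + n)) (gauss (suc a) (suc (N + n)) f)
  Z = shift (suc a) (gauss (2 + a) (N + n) f)
  x = shift (T n) X m
  y = shift (T n) Y m
  z = shift (T n) Z m
  regroup : ∀ x y z → y ℤ.+ (z ℤ.+ x) ≡ x ℤ.+ y ℤ.+ z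
  regroup = solve-∀
  a+n≡N : a + n ≡ N
  a+n≡N = ℕ.suc-injective (ℕ.suc-injective eq)
  2N+2 : double (suc N) ≡ 2 + a + (N + n)
  2N+2 = cong (λ t → 2 + t) (trans (double≡+ N) (trans (cong (λ t → N + t) (sym a+n≡N)) (swap N a n)))
    where
    swap : ∀ N a n → N + (a + n) ≡ a + (N + n)
    swap = ℕSolver.solve-∀
  middle : 1+q^ (double (suc N)) (layer N n f) m ≡ y
  middle = begin
    1+q^ (double (suc N)) (layer N n f) m
      ≡⟨ cong (λ t → 1+q^ t (layer N n f) m) 2N+2 ⟩
    1+q^ (2 + a + (N + n)) (layer N n f) m
      ≡⟨ ≗-cong (factor-isMultiplier 1ℤ (2 + a + (N + n))) (layer-gauss N n (suc a) f (cong suc a+n≡N)) m ⟩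
    1+q^ (2 + a + (N + n)) (shift (T n) (gauss (suc a) (suc (N + n)) f)) m
      ≡⟨ factor-homo (shift-isMultiplier (T n)) 1ℤ (2 + a + (N + n)) _ m ⟨
    y ∎
  exponents : suc N + T (suc n) ≡ T n + (2 + (N + n))
  exponents = trans (cong (λ t → suc N + t) (T-suc n)) (sum N n (T n))
    where
    sum : ∀ N n t → suc N + (suc n + t) ≡ t + (2 + (N + n))
    sum = ℕSolver.solve-∀
  upper : shift (suc N) (layer N (suc n) f) m ≡ x
  upper = begin
    shift (suc N) (layer N (suc n) f) m
      ≡⟨ shift-cong (suc N) (layer-gauss N (suc n) a f (trans (ℕ.+-suc a n) (cong suc a+n≡N))) m ⟩
    shift (suc N) (shift (T (suc n)) (gauss a (suc (N + suc n)) f)) m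
      ≡⟨ shift-+ (suc N) (T (suc n)) _ m ⟩
    shift (suc N + T (suc n)) (gauss a (suc (N + suc n)) f) m
      ≡⟨ shift-exp _ exponents m ⟩
    shift (T n + (2 + (N + n))) (gauss a (suc (N + suc n)) f) m
      ≡⟨ shift-+ (T n) (2 + (N + n)) _ m ⟨
    shift (T n) (shift (2 + (N + n)) (gauss a (suc (N + suc n)) f)) m
      ≡⟨ cong (λ t → shift (T n) (shift (2 + (N + n)) (gauss a (suc t) f)) m) (ℕ.+-suc N n) ⟩
    x ∎

-- Coefficients of the polynomials V_n

-- chebyshev k n is the coefficient of z^k in V_n.
chebyshev : ℕ → ℕ → ℤ
chebyshev zero    zero          = 1ℤ
chebyshev (suc k) zero          = 0ℤ
chebyshev zero    (suc zero)    = ℤ.- chebyshev zero zero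
chebyshev (suc k) (suc zero)    = chebyshev k zero ℤ.- chebyshev (suc k) zero
chebyshev zero    (suc (suc n)) = ℤ.- chebyshev zero n
chebyshev (suc k) (suc (suc n)) = chebyshev k (suc n) ℤ.- chebyshev (suc k) n

chebyshev₀ : ∀ i → chebyshev 0 (double i) ≡ -1ℤ ℤ.^ i × chebyshev 0 (suc (double i)) ≡ ℤ.- (-1ℤ ℤ.^ i)
chebyshev₀ zero    = refl , refl
chebyshev₀ (suc i) with e , o ← chebyshev₀ i =
  trans (cong ℤ.-_ e) (neg≡-1* (-1ℤ ℤ.^ i)) , cong ℤ.-_ (trans o (neg≡-1* (-1ℤ ℤ.^ i)))
  where
  neg≡-1* : ∀ s → ℤ.- s ≡ -1ℤ ℤ.* s
  neg≡-1* = solve-∀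

chebyshev₁ : ∀ i → chebyshev 1 (double i) ≡ -1ℤ ℤ.^ i ℤ.* + i × chebyshev 1 (suc (double i)) ≡ -1ℤ ℤ.^ i ℤ.* + suc i
chebyshev₁ zero    = refl , refl
chebyshev₁ (suc i) with e₀ , o₀ ← chebyshev₀ i | e₀′ , _ ← chebyshev₀ (suc i) | e , o ← chebyshev₁ i =
  trans (cong₂ ℤ._-_ o₀ e) (step₁ (-1ℤ ℤ.^ i) (+ i)) ,
  trans (cong₂ ℤ._-_ e₀′ o) (step₂ (-1ℤ ℤ.^ i) (+ i))
  where
  step₁ : ∀ s x → ℤ.- s ℤ.- s ℤ.* x ≡ -1ℤ ℤ.* s ℤ.* (1ℤ ℤ.+ x)
  step₁ = solve-∀
  step₂ : ∀ s x → -1ℤ ℤ.* s ℤ.- s ℤ.* (1ℤ ℤ.+ x) ≡ -1ℤ ℤ.* s ℤ.* (1ℤ ℤ.+ (1ℤ ℤ.+ x))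
  step₂ = solve-∀

-- Up to sign, each recurrence step adds the value i + 1 from `chebyshev₁` to the previous
-- coefficient of the same parity; these increments build up T_{i+1} = (i + 1) + T_i.
chebyshev₂ : ∀ i → chebyshev 2 (double i) ≡ ℤ.- (-1ℤ ℤ.^ i) ℤ.* + T i × chebyshev 2 (suc (double i)) ≡ -1ℤ ℤ.^ i ℤ.* + T i
chebyshev₂ zero    = refl , refl
chebyshev₂ (suc i) with e₁ , o₁ ← chebyshev₁ i | e₁′ , _ ← chebyshev₁ (suc i) | e , o ← chebyshev₂ i rewrite T-suc i =
  trans (cong₂ ℤ._-_ o₁ e) (step₁ (-1ℤ ℤ.^ i) (+ suc i) (+ T i)) ,
  trans (cong₂ ℤ._-_ e₁′ o) (step₂ (-1ℤ ℤ.^ i) (+ suc i) (+ T i))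
  where
  step₁ : ∀ s x t → s ℤ.* x ℤ.- ℤ.- s ℤ.* t ≡ ℤ.- (-1ℤ ℤ.* s) ℤ.* (x ℤ.+ t)
  step₁ = solve-∀
  step₂ : ∀ s x t → -1ℤ ℤ.* s ℤ.* x ℤ.- s ℤ.* t ≡ -1ℤ ℤ.* s ℤ.* (x ℤ.+ t)
  step₂ = solve-∀

-1^double : ∀ k → -1ℤ ℤ.^ double k ≡ 1ℤ
-1^double zero    = refl
-1^double (suc k) = cong (λ t → -1ℤ ℤ.* (-1ℤ ℤ.* t)) (-1^double k)

-1^T-suc-double : ∀ i → -1ℤ ℤ.^ T (suc (double i)) ≡ -1ℤ ℤ.* -1ℤ ℤ.^ T (double i)
-1^T-suc-double i = begin
  -1ℤ ℤ.^ T (suc (double i))                                ≡⟨ cong (-1ℤ ℤ.^_) (T-suc (double i)) ⟩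
  -1ℤ ℤ.* -1ℤ ℤ.^ (double i + T (double i))                 ≡⟨ cong (-1ℤ ℤ.*_) (ℤ.^-distribˡ-+-* -1ℤ (double i) _) ⟩
  -1ℤ ℤ.* (-1ℤ ℤ.^ double i ℤ.* -1ℤ ℤ.^ T (double i))       ≡⟨ cong (λ t → -1ℤ ℤ.* (t ℤ.* -1ℤ ℤ.^ T (double i))) (-1^double i) ⟩
  -1ℤ ℤ.* (1ℤ ℤ.* -1ℤ ℤ.^ T (double i))                     ≡⟨ cong (-1ℤ ℤ.*_) (ℤ.*-identityˡ _) ⟩
  -1ℤ ℤ.* -1ℤ ℤ.^ T (double i)                              ∎
  where open ≡-Reasoning

-- T_{2i} = i (2i + 1) has the parity of i.
-1^T-double : ∀ i → -1ℤ ℤ.^ T (double i) ≡ -1ℤ ℤ.^ i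
-1^T-double zero    = refl
-1^T-double (suc i) = begin
  -1ℤ ℤ.^ T (double (suc i))                                            ≡⟨ cong (-1ℤ ℤ.^_) (T-suc (suc (double i))) ⟩
  -1ℤ ℤ.^ (double (suc i) + T (suc (double i)))                         ≡⟨ ℤ.^-distribˡ-+-* -1ℤ (double (suc i)) _ ⟩
  -1ℤ ℤ.^ double (suc i) ℤ.* -1ℤ ℤ.^ T (suc (double i))                 ≡⟨ cong₂ ℤ._*_ (-1^double (suc i)) (-1^T-suc-double i) ⟩
  1ℤ ℤ.* (-1ℤ ℤ.* -1ℤ ℤ.^ T (double i))                                 ≡⟨ ℤ.*-identityˡ _ ⟩
  -1ℤ ℤ.* -1ℤ ℤ.^ T (double i)                                          ≡⟨ cong (-1ℤ ℤ.*_) (-1^T-double i) ⟩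
  -1ℤ ℤ.^ suc i                                                         ∎
  where open ≡-Reasoning

⌈1+double/2⌉ : ∀ i → ⌈ suc (double i) /2⌉ ≡ suc i
⌈1+double/2⌉ zero    = refl
⌈1+double/2⌉ (suc i) = cong suc (⌈1+double/2⌉ i)

⌈double/2⌉ : ∀ i → ⌈ double i /2⌉ ≡ i
⌈double/2⌉ zero    = refl
⌈double/2⌉ (suc i) = cong suc (⌈double/2⌉ i)

even∨odd : ∀ n → (∃ λ i → n ≡ double i) ⊎ (∃ λ i → n ≡ suc (double i))
even∨odd zero = inj₁ (0 , refl)
even∨odd (suc n) with even∨odd n
... | inj₁ (i , refl) = inj₂ (i , refl)
... | inj₂ (i , refl) = inj₁ (suc i , refl)

-- Here `suc r` is the summation index of the theorem, so that no truncated predecessor appears.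
chebyshev₂-closed : ∀ r → chebyshev 2 (2 + r) ≡ -1ℤ ℤ.^ T r ℤ.* + T ⌈ suc r /2⌉
chebyshev₂-closed r with even∨odd r
... | inj₁ (i , refl) = trans (proj₁ (chebyshev₂ (suc i)))
  (cong₂ (λ s t → s ℤ.* + T t) (trans (double-neg (-1ℤ ℤ.^ i)) (sym (-1^T-double i))) (sym (⌈1+double/2⌉ i)))
  where
  double-neg : ∀ s → ℤ.- (-1ℤ ℤ.* s) ≡ s
  double-neg = solve-∀
... | inj₂ (i , refl) = trans (proj₂ (chebyshev₂ (suc i)))
  (cong₂ (λ s t → s ℤ.* + T t) (sym (trans (-1^T-suc-double i) (cong (-1ℤ ℤ.*_) (-1^T-double i)))) (sym (⌈double/2⌉ (suc i))))

-- Elementary symmetric functions and the triple product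

-- The first B terms of q^y / (1 + q^{2y}) = Σ_r (-1)^r q^{(2r+1)y}.
odd-multiples : ℕ → ℕ → Series → Series
odd-multiples B y f m = ∑ B (λ r → -1ℤ ℤ.^ r ℤ.* shift ((2 * r + 1) * y) f m)

-- In an alternating geometric sum with ratio -q^{2y}, consecutive terms cancel after multiplication
-- by 1 + q^{2y}; only the two ends remain.
telescope : ∀ B y f m → 1+q^ (double y) (odd-multiples B y f) m ≡
  shift y f m ℤ.- -1ℤ ℤ.^ B ℤ.* shift ((2 * B + 1) * y) f m
telescope zero    y f m = trans (𝟎-homo (factor-isMultiplier 1ℤ (double y)) {λ _ → 0ℤ} (λ _ → refl) m)
  (trans (cancel (shift y f m)) (cong (λ t → shift y f m ℤ.- 1ℤ ℤ.* t) (shift-exp f (sym (ℕ.*-identityˡ y)) m)))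
  where
  cancel : ∀ s → 0ℤ ≡ s ℤ.- 1ℤ ℤ.* s
  cancel s = sym (trans (cong (λ t → s ℤ.- t) (ℤ.*-identityˡ s)) (ℤ.+-inverseʳ s))
telescope (suc B) y f m = begin
  1+q^ (double y) (odd-multiples (suc B) y f) m
    ≡⟨ ≗-cong ℱ (λ m → ∑-last B (λ r → -1ℤ ℤ.^ r ℤ.* shift ((2 * r + 1) * y) f m)) m ⟩
  1+q^ (double y) (odd-multiples B y f ⊕ s · t) m
    ≡⟨ ⊕-homo ℱ (odd-multiples B y f) (s · t) m ⟩
  1+q^ (double y) (odd-multiples B y f) m ℤ.+ 1+q^ (double y) (s · t) m
    ≡⟨ cong₂ ℤ._+_ (telescope B y f m) (·-homo ℱ s t m) ⟩
  shift y f m ℤ.- s ℤ.* t m ℤ.+ s ℤ.* (t m ℤ.+ 1ℤ ℤ.* shift (double y) t m)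
    ≡⟨ collapse (shift y f m) s (t m) (shift (double y) t m) ⟩
  shift y f m ℤ.- -1ℤ ℤ.* s ℤ.* shift (double y) t m
    ≡⟨ cong (λ u → shift y f m ℤ.- -1ℤ ℤ.* s ℤ.* u) (trans (shift-+ (double y) ((2 * B + 1) * y) f m) (shift-exp f exponents m)) ⟩
  shift y f m ℤ.- -1ℤ ℤ.^ suc B ℤ.* shift ((2 * suc B + 1) * y) f m
    ∎
  where
  open ≡-Reasoning
  ℱ = factor-isMultiplier 1ℤ (double y)
  s = -1ℤ ℤ.^ B
  t = shift ((2 * B + 1) * y) f
  collapse : ∀ u s t v → u ℤ.- s ℤ.* t ℤ.+ s ℤ.* (t ℤ.+ 1ℤ ℤ.* v) ≡ u ℤ.- -1ℤ ℤ.* s ℤ.* v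
  collapse = solve-∀
  exponents : double y + (2 * B + 1) * y ≡ (2 * suc B + 1) * y
  exponents = trans (cong (_+ (2 * B + 1) * y) (double≡+ y)) (sum y B)
    where
    sum : ∀ y B → y + y + (2 * B + 1) * y ≡ (2 * suc B + 1) * y
    sum = ℕSolver.solve-∀

-- The far end left by `telescope` has degree (2B + 1)(y + 1) > B, which relies on the multiplied
-- part being positive.
1+q²-odd-multiples : ∀ B y f → 1+q^ (double (suc y)) (odd-multiples B (suc y) f) ≈[ B ] shift (suc y) f
1+q²-odd-multiples B y f {m} m<B = begin
  1+q^ (double (suc y)) (odd-multiples B (suc y) f) m
    ≡⟨ telescope B (suc y) f m ⟩
  shift (suc y) f m ℤ.- -1ℤ ℤ.^ B ℤ.* shift ((2 * B + 1) * suc y) f m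
    ≡⟨ cong (λ t → shift (suc y) f m ℤ.- -1ℤ ℤ.^ B ℤ.* t) (shift-< ((2 * B + 1) * suc y) f m<) ⟩
  shift (suc y) f m ℤ.- -1ℤ ℤ.^ B ℤ.* 0ℤ
    ≡⟨ cong (λ t → shift (suc y) f m ℤ.- t) (ℤ.*-zeroʳ (-1ℤ ℤ.^ B)) ⟩
  shift (suc y) f m ℤ.+ 0ℤ
    ≡⟨ ℤ.+-identityʳ _ ⟩
  shift (suc y) f m
    ∎
  where
  open ≡-Reasoning
  m< : m < (2 * B + 1) * suc y
  m< = ℕ.≤-trans m<B (ℕ.≤-trans (ℕ.m≤m+n B _) (ℕ.≤-trans (ℕ.m≤m+n (2 * B) 1) (ℕ.m≤m*n (2 * B + 1) (suc y))))

-- The k-th elementary symmetric function of the series q^y / (1 + q^{2y}), 1 ≤ y ≤ N, up to q^B.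
elementary : ℕ → ℕ → ℕ → Series
elementary B zero    N   = 𝟏
elementary B (suc k) N m = ∑ N (λ y → odd-multiples B (suc y) (elementary B k y) m)

∏[1+q²ˣ] : ℕ → Series → Series
∏[1+q²ˣ] = ∏ (1+q^ ∘ double)

∏[1+q²ˣ]-isMultiplier : ∀ N → IsMultiplier (∏[1+q²ˣ] N)
∏[1+q²ˣ]-isMultiplier = ∏-isMultiplier (factor-isMultiplier 1ℤ ∘ double)

-- Multiplication by z acts on the V_n as the sum of the steps n to n + 1 and n to `pred n`. Its
-- matrix is symmetric, with the reflection as the diagonal entry at 0, so it may be moved from `v`
-- to `c`; the cut at `L` leaves the boundary term.
∑-by-parts : ∀ (v v′ c : ℕ → ℤ) → v′ 0 ≡ v 1 ℤ.+ v 0 → (∀ n → v′ (suc n) ≡ v (2 + n) ℤ.+ v n) →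
  ∀ L → ∑ (suc L) (λ n → v′ n ℤ.* c n) ≡
        ∑ (suc L) (λ n → v n ℤ.* (c (pred n) ℤ.+ c (suc n))) ℤ.+ (v (suc L) ℤ.* c L ℤ.- v L ℤ.* c (suc L))
∑-by-parts v v′ c v′₀ v′₊ zero = trans (cong (λ t → t ℤ.* c 0 ℤ.+ 0ℤ) v′₀) (expand (v 0) (v 1) (c 0) (c 1))
  where
  expand : ∀ v₀ v₁ c₀ c₁ → (v₁ ℤ.+ v₀) ℤ.* c₀ ℤ.+ 0ℤ ≡
    v₀ ℤ.* (c₀ ℤ.+ c₁) ℤ.+ 0ℤ ℤ.+ (v₁ ℤ.* c₀ ℤ.- v₀ ℤ.* c₁)
  expand = solve-∀
∑-by-parts v v′ c v′₀ v′₊ (suc L) = begin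
  ∑ (2 + L) (λ n → v′ n ℤ.* c n)
    ≡⟨ ∑-last (suc L) (λ n → v′ n ℤ.* c n) ⟩
  ∑ (suc L) (λ n → v′ n ℤ.* c n) ℤ.+ v′ (suc L) ℤ.* c (suc L)
    ≡⟨ cong₂ (λ s t → s ℤ.+ t ℤ.* c (suc L)) (∑-by-parts v v′ c v′₀ v′₊ L) (v′₊ L) ⟩
  S ℤ.+ (v (suc L) ℤ.* c L ℤ.- v L ℤ.* c (suc L)) ℤ.+ (v (2 + L) ℤ.+ v L) ℤ.* c (suc L)
    ≡⟨ regroup S (v L) (v (suc L)) (v (2 + L)) (c L) (c (suc L)) (c (2 + L)) ⟩
  S ℤ.+ v (suc L) ℤ.* (c L ℤ.+ c (2 + L)) ℤ.+ (v (2 + L) ℤ.* c (suc L) ℤ.- v (suc L) ℤ.* c (2 + L))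
    ≡⟨ cong (ℤ._+ (v (2 + L) ℤ.* c (suc L) ℤ.- v (suc L) ℤ.* c (2 + L))) (∑-last (suc L) (λ n → v n ℤ.* (c (pred n) ℤ.+ c (suc n)))) ⟨
  ∑ (2 + L) (λ n → v n ℤ.* (c (pred n) ℤ.+ c (suc n))) ℤ.+ (v (2 + L) ℤ.* c (suc L) ℤ.- v (suc L) ℤ.* c (2 + L))
    ∎
  where
  open ≡-Reasoning
  S = ∑ (suc L) (λ n → v n ℤ.* (c (pred n) ℤ.+ c (suc n)))
  regroup : ∀ S v₀ v₁ v₂ c₀ c₁ c₂ →
    S ℤ.+ (v₁ ℤ.* c₀ ℤ.- v₀ ℤ.* c₁) ℤ.+ (v₂ ℤ.+ v₀) ℤ.* c₁ ≡ S ℤ.+ v₁ ℤ.* (c₀ ℤ.+ c₂) ℤ.+ (v₂ ℤ.* c₁ ℤ.- v₁ ℤ.* c₂)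
  regroup = solve-∀

-- The linear functional on polynomials in z with value `v n` at V_n, applied to ∏_{x≤N} (1 + z q^x
-- + q^{2x}). The bound `L` is independent of `N` so that it can later follow the number of terms in
-- a partial sum.
theta : (ℕ → ℤ) → ℕ → ℕ → Series
theta v N L m = ∑ (suc L) (λ n → v n ℤ.* layer N n 𝟏 m)

-- The hypotheses say that `v′` is `v` composed with multiplication by z; the new factor 1 + z
-- q^{N+1} + q^{2N+2} thus splits into a `v` part and a `v′` part. `N < L` kills the boundary term
-- of `∑-by-parts`.
theta-suc : ∀ (v v′ : ℕ → ℤ) → v′ 0 ≡ v 1 ℤ.+ v 0 → (∀ n → v′ (suc n) ≡ v (2 + n) ℤ.+ v n) →
  ∀ N L → N < L → theta v (suc N) L ≗ 1+q^ (double (suc N)) (theta v N L) ⊕ shift (suc N) (theta v′ N L)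
theta-suc v v′ v′₀ v′₊ N L N<L m = begin
  ∑ (suc L) (λ n → v n ℤ.* (x n ℤ.+ y n))
    ≡⟨ ∑-cong (suc L) {λ n → v n ℤ.* (x n ℤ.+ y n)} (λ n _ → ℤ.*-distribˡ-+ (v n) (x n) (y n)) ⟩
  ∑ (suc L) (λ n → v n ℤ.* x n ℤ.+ v n ℤ.* y n)
    ≡⟨ ∑-distrib-+ (suc L) (λ n → v n ℤ.* x n) (λ n → v n ℤ.* y n) ⟩
  ∑ (suc L) (λ n → v n ℤ.* x n) ℤ.+ ∑ (suc L) (λ n → v n ℤ.* y n)
    ≡⟨ cong₂ ℤ._+_ (pull (factor-isMultiplier 1ℤ (double (suc N))) c) (pull (shift-isMultiplier (suc N)) d) ⟩
  1+q^ (double (suc N)) (theta v N L) m ℤ.+ shift (suc N) (λ m → ∑ (suc L) (λ n → v n ℤ.* d n m)) m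
    ≡⟨ cong (λ t → 1+q^ (double (suc N)) (theta v N L) m ℤ.+ t) (shift-cong (suc N) (λ i → sym (parts i)) m) ⟩
  1+q^ (double (suc N)) (theta v N L) m ℤ.+ shift (suc N) (theta v′ N L) m
    ∎
  where
  open ≡-Reasoning
  c d : ℕ → Series
  c n = layer N n 𝟏
  d n = c (pred n) ⊕ c (suc n)
  x y : ℕ → ℤ
  x n = 1+q^ (double (suc N)) (c n) m
  y n = shift (suc N) (d n) m
  pull : ∀ {L′} → IsMultiplier L′ → ∀ (g : ℕ → Series) →
    ∑ (suc L) (λ n → v n ℤ.* L′ (g n) m) ≡ L′ (λ m → ∑ (suc L) (λ n → v n ℤ.* g n m)) m
  pull ℒ g = sym (trans (∑-homo ℒ (suc L) (λ n → v n · g n) m) (∑-cong (suc L) (λ n _ → ·-homo ℒ (v n) (g n) m)))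
  parts : ∀ i → theta v′ N L i ≡ ∑ (suc L) (λ n → v n ℤ.* d n i)
  parts i = begin
    theta v′ N L i
      ≡⟨ ∑-by-parts v v′ (λ n → c n i) v′₀ v′₊ L ⟩
    S ℤ.+ (v (suc L) ℤ.* c L i ℤ.- v L ℤ.* c (suc L) i)
      ≡⟨ cong₂ (λ s t → S ℤ.+ (v (suc L) ℤ.* s ℤ.- v L ℤ.* t)) (layer-> N L 𝟏 N<L i) (layer-> N (suc L) 𝟏 (ℕ.m<n⇒m<1+n N<L) i) ⟩
    S ℤ.+ (v (suc L) ℤ.* 0ℤ ℤ.- v L ℤ.* 0ℤ)
      ≡⟨ vanish S (v (suc L)) (v L) ⟩
    S ∎
    where
    S = ∑ (suc L) (λ n → v n ℤ.* d n i)
    vanish : ∀ S x y → S ℤ.+ (x ℤ.* 0ℤ ℤ.- y ℤ.* 0ℤ) ≡ S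
    vanish = solve-∀

-- The z^k-coefficient of ∏_{x≤N} (1 + z q^x + q^{2x}), computed in two ways.
elementary-theta : ∀ B k N L → N ≤ L → ∏[1+q²ˣ] N (elementary B k N) ≈[ B ] theta (chebyshev k) N L
elementary-theta B k zero L _ {m} _ = begin
  elementary B k 0 m                                     ≡⟨ constant-term k ⟩
  chebyshev k 0 ℤ.* 𝟏 m ℤ.+ 0ℤ                           ≡⟨ cong (λ t → chebyshev k 0 ℤ.* 𝟏 m ℤ.+ t) (∑-zero L (λ n _ → ℤ.*-zeroʳ (chebyshev k (suc n)))) ⟨
  theta (chebyshev k) 0 L m                              ∎
  where
  open ≡-Reasoning
  constant-term : ∀ k → elementary B k 0 m ≡ chebyshev k 0 ℤ.* 𝟏 m ℤ.+ 0ℤ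
  constant-term zero    = sym (trans (ℤ.+-identityʳ _) (ℤ.*-identityˡ (𝟏 m)))
  constant-term (suc k) = refl
-- A multiple of z has no constant term, so the functional `v′` belonging to `chebyshev 0` is `𝟎`.
elementary-theta B zero (suc N) L N<L {m} m<B = begin
  1+q^ (double (suc N)) (∏[1+q²ˣ] N 𝟏) m
    ≡⟨ ≈-cong (factor-isMultiplier 1ℤ (double (suc N))) B (elementary-theta B 0 N L (ℕ.<⇒≤ N<L)) m<B ⟩
  1+q^ (double (suc N)) (theta (chebyshev 0) N L) m
    ≡⟨ ℤ.+-identityʳ _ ⟨
  1+q^ (double (suc N)) (theta (chebyshev 0) N L) m ℤ.+ 0ℤ
    ≡⟨ cong (λ t → 1+q^ (double (suc N)) (theta (chebyshev 0) N L) m ℤ.+ t)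
         (shift-𝟎 (suc N) (λ i → ∑-zero (suc L) (λ n _ → refl)) m) ⟨
  1+q^ (double (suc N)) (theta (chebyshev 0) N L) m ℤ.+ shift (suc N) (theta 𝟎 N L) m
    ≡⟨ theta-suc (chebyshev 0) 𝟎 refl (λ n → sym (ℤ.+-inverseˡ (chebyshev 0 n))) N L N<L m ⟨
  theta (chebyshev 0) (suc N) L m
    ∎
  where open ≡-Reasoning
elementary-theta B (suc k) (suc N) L N<L {m} m<B = begin
  ∏[1+q²ˣ] (suc N) (elementary B (suc k) (suc N)) m
    ≡⟨ ≗-cong 𝒦 (λ m → ∑-last N (λ y → odd-multiples B (suc y) (elementary B k y) m)) m ⟩
  ∏[1+q²ˣ] (suc N) (elementary B (suc k) N ⊕ u) m
    ≡⟨ ⊕-homo 𝒦 (elementary B (suc k) N) u m ⟩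
  1+q^ (double (suc N)) (∏[1+q²ˣ] N (elementary B (suc k) N)) m ℤ.+ 1+q^ (double (suc N)) (∏[1+q²ˣ] N u) m
    ≡⟨ cong₂ ℤ._+_
         (≈-cong (factor-isMultiplier 1ℤ (double (suc N))) B (elementary-theta B (suc k) N L (ℕ.<⇒≤ N<L)) m<B)
         new-terms ⟩
  1+q^ (double (suc N)) (theta (chebyshev (suc k)) N L) m ℤ.+ shift (suc N) (theta (chebyshev k) N L) m
    ≡⟨ theta-suc (chebyshev (suc k)) (chebyshev k) (recurrence (chebyshev k 0) (chebyshev (suc k) 0))
         (λ n → recurrence (chebyshev k (suc n)) (chebyshev (suc k) n)) N L N<L m ⟨
  theta (chebyshev (suc k)) (suc N) L m
    ∎
  where
  open ≡-Reasoning
  𝒦 = ∏[1+q²ˣ]-isMultiplier (suc N)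
  u = odd-multiples B (suc N) (elementary B k N)
  recurrence : ∀ x y → x ≡ x ℤ.- y ℤ.+ y
  recurrence = solve-∀
  -- The products whose largest index is N + 1: the new factor 1 + q^{2N+2} clears the denominator
  -- of q^{N+1} / (1 + q^{2N+2}), leaving the z q^{N+1} part of `theta-suc`.
  new-terms : 1+q^ (double (suc N)) (∏[1+q²ˣ] N u) m ≡ shift (suc N) (theta (chebyshev k) N L) m
  new-terms = begin
    1+q^ (double (suc N)) (∏[1+q²ˣ] N u) m
      ≡⟨ factor-homo (∏[1+q²ˣ]-isMultiplier N) 1ℤ (double (suc N)) u m ⟨
    ∏[1+q²ˣ] N (1+q^ (double (suc N)) u) m
      ≡⟨ ≈-cong (∏[1+q²ˣ]-isMultiplier N) B (1+q²-odd-multiples B N (elementary B k N)) m<B ⟩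
    ∏[1+q²ˣ] N (shift (suc N) (elementary B k N)) m
      ≡⟨ shift-homo (∏[1+q²ˣ]-isMultiplier N) (suc N) (elementary B k N) m ⟩
    shift (suc N) (∏[1+q²ˣ] N (elementary B k N)) m
      ≡⟨ ≈-cong (shift-isMultiplier (suc N)) B (elementary-theta B k N L (ℕ.<⇒≤ N<L)) m<B ⟩
    shift (suc N) (theta (chebyshev k) N L) m
      ∎

∏-homo : ∀ {L} → IsMultiplier L → ∀ s (e : ℕ → ℕ) n f → L (∏ (factor s ∘ e) n f) ≗ ∏ (factor s ∘ e) n (L f)
∏-homo ℒ s e zero    f m = refl
∏-homo ℒ s e (suc n) f m = trans (factor-homo ℒ s (e (suc n)) (∏ (factor s ∘ e) n f) m)
  (≗-cong (factor-isMultiplier s (e (suc n))) (∏-homo ℒ s e n f) m)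

∏-cancel : ∀ s n {f g} M → ∏ (factor s ∘ double) n f ≈[ M ] ∏ (factor s ∘ double) n g → f ≈[ M ] g
∏-cancel s zero    M eq = eq
∏-cancel s (suc n) {f} {g} M eq = ∏-cancel s n {f} {g} M
  (factor-cancel s (suc (double n)) {∏ (factor s ∘ double) n f} {∏ (factor s ∘ double) n g} M eq)

-- Partitions with distinct odd parts

module _ {A B : Set} {P : A → Set} {Q : B → Set} (P? : Decidable P) (Q? : Decidable Q) where

  length-filter-map : ∀ {f : A → B} {xs} → All (λ x → (Q (f x) → P x) × (P x → Q (f x))) xs →
    length (filter Q? (map f xs)) ≡ length (filter P? xs)
  length-filter-map {f} {[]}     []             = refl
  length-filter-map {f} {x ∷ xs} ((to , from) ∷ rest) with Q? (f x) | P? x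
  ... | yes _ | yes _ = cong suc (length-filter-map rest)
  ... | no _  | no _  = length-filter-map rest
  ... | yes q | no ¬p = contradiction (to q) ¬p
  ... | no ¬q | yes p = contradiction (from p) ¬q

module _ {B : Set} {Q : B → Set} (Q? : Decidable Q) where

  length-filter-map-none : ∀ {A : Set} {f : A → B} xs → (∀ x → ¬ Q (f x)) → length (filter Q? (map f xs)) ≡ 0
  length-filter-map-none []       ¬Q = refl
  length-filter-map-none {f = f} (x ∷ xs) ¬Q with Q? (f x)
  ... | yes q = contradiction q (¬Q x)
  ... | no _  = length-filter-map-none xs ¬Q

  length-filter-concat : ∀ (g : ℕ → List B) h n →
    + length (filter Q? (concat (map g (applyUpTo h n)))) ≡ ∑ n (λ j → + length (filter Q? (g (h j))))
  length-filter-concat g h zero    = refl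
  length-filter-concat g h (suc n) = begin
    + length (filter Q? (g (h 0) ++ rest))
      ≡⟨ cong (+_ ∘ length) (filter-++ Q? (g (h 0)) rest) ⟩
    + length (filter Q? (g (h 0)) ++ filter Q? rest)
      ≡⟨ cong +_ (length-++ (filter Q? (g (h 0)))) ⟩
    + length (filter Q? (g (h 0))) ℤ.+ + length (filter Q? rest)
      ≡⟨ cong (λ t → + length (filter Q? (g (h 0))) ℤ.+ t) (length-filter-concat g (h ∘ suc) n) ⟩
    ∑ (suc n) (λ j → + length (filter Q? (g (h j))))
      ∎
    where
    open ≡-Reasoning
    rest = concat (map g (applyUpTo (h ∘ suc) n))

pod≤ : ℕ → Series
pod≤ k n = + length (filter oddPartsDistinct? (partitions≤ k n))

-- The argument `n` is the sum of the parts other than the `j` copies of `suc k`, not the total.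
pod≤-multiplicity : ℕ → ℕ → Series
pod≤-multiplicity k j n = + length (filter oddPartsDistinct? (map (replicate j (suc k) ++_) (partitions≤ k n)))

pod≤-suc : ∀ k n → pod≤ (suc k) n ≡ ∑ (suc (n / suc k)) (λ j → pod≤-multiplicity k j (n ∸ j * suc k))
pod≤-suc k n = length-filter-concat oddPartsDistinct?
  (λ j → map (replicate j (suc k) ++_) (partitions≤ k (n ∸ j * suc k))) id (suc (n / suc k))

filter-replicate-even : ∀ {k} → 2 ∣ k → ∀ j xs → filter odd? (replicate j k ++ xs) ≡ filter odd? xs
filter-replicate-even 2∣k zero    xs = refl
filter-replicate-even {k} 2∣k (suc j) xs =
  trans (filter-reject odd? {xs = replicate j k ++ xs} (λ odd → odd 2∣k)) (filter-replicate-even 2∣k j xs)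

multiplicity-even : ∀ {k} → 2 ∣ suc k → ∀ j n → pod≤-multiplicity k j n ≡ pod≤ k n
multiplicity-even {k} 2∣k j n = cong +_ (length-filter-map oddPartsDistinct? oddPartsDistinct?
  (All.universal (λ xs → subst Unique (eq xs) , subst Unique (sym (eq xs))) (partitions≤ k n)))
  where
  eq : ∀ xs → filter odd? (replicate j (suc k) ++ xs) ≡ filter odd? xs
  eq = filter-replicate-even 2∣k j

multiplicity-0 : ∀ k n → pod≤-multiplicity k 0 n ≡ pod≤ k n
multiplicity-0 k n = cong +_ (length-filter-map oddPartsDistinct? oddPartsDistinct? (All.universal (λ _ → id , id) (partitions≤ k n)))

multiplicity-1-odd : ∀ {k} → Odd (suc k) → ∀ n → pod≤-multiplicity k 1 n ≡ pod≤ k n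
multiplicity-1-odd {k} odd n = cong +_ (length-filter-map oddPartsDistinct? oddPartsDistinct? (All.tabulate λ {xs} xs∈ →
  to xs , from xs (proj₂ (partitions≤-sound k n xs∈))))
  where
  eq : ∀ xs → filter odd? (suc k ∷ xs) ≡ suc k ∷ filter odd? xs
  eq xs = filter-accept odd? {xs = xs} odd
  to : ∀ xs → OddPartsDistinct (suc k ∷ xs) → OddPartsDistinct xs
  to xs u rewrite eq xs with _ ∷ u′ ← u = u′
  from : ∀ xs → All (_≤ k) xs → OddPartsDistinct xs → OddPartsDistinct (suc k ∷ xs)
  from xs xs≤k u rewrite eq xs =
    All.filter⁺ odd? (All.map (λ x≤k 1+k≡x → ℕ.1+n≰n (subst (_≤ k) (sym 1+k≡x) x≤k)) xs≤k) ∷ u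

multiplicity-2+-odd : ∀ {k} → Odd (suc k) → ∀ j n → pod≤-multiplicity k (2 + j) n ≡ 0ℤ
multiplicity-2+-odd {k} odd j n = cong +_ (length-filter-map-none oddPartsDistinct? (partitions≤ k n) repeated)
  where
  repeated : ∀ xs → ¬ OddPartsDistinct (suc k ∷ suc k ∷ replicate j (suc k) ++ xs)
  repeated xs u
    rewrite filter-accept odd? {xs = suc k ∷ replicate j (suc k) ++ xs} odd
          | filter-accept odd? {xs = replicate j (suc k) ++ xs} odd
    with (k≢k ∷ _) ∷ _ ← u = k≢k refl

pod≤-suc-≈ : ∀ k → pod≤ (suc k) ≈[ suc k ] pod≤ k
pod≤-suc-≈ k {n} n<K = begin
  pod≤ (suc k) n
    ≡⟨ pod≤-suc k n ⟩
  ∑ (suc (n / suc k)) (λ j → pod≤-multiplicity k j (n ∸ j * suc k))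
    ≡⟨ cong (λ t → ∑ (suc t) (λ j → pod≤-multiplicity k j (n ∸ j * suc k))) (m<n⇒m/n≡0 n<K) ⟩
  pod≤-multiplicity k 0 n ℤ.+ 0ℤ
    ≡⟨ ℤ.+-identityʳ _ ⟩
  pod≤-multiplicity k 0 n
    ≡⟨ multiplicity-0 k n ⟩
  pod≤ k n
    ∎
  where open ≡-Reasoning

pod≤-stable : ∀ d n → pod≤ (d + n) n ≡ + pod n
pod≤-stable zero    n = refl
pod≤-stable (suc d) n = trans (pod≤-suc-≈ (d + n) (s≤s (ℕ.m≤n+m n d))) (pod≤-stable d n)

pod≤-odd : ∀ {k} → Odd (suc k) → pod≤ (suc k) ≗ 1+q^ (suc k) (pod≤ k)
pod≤-odd {k} odd n with ℕ.<-≤-connex n (suc k)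
... | inj₁ n<K = trans (pod≤-suc-≈ k n<K) (sym (factor-≈ 1ℤ (suc k) (pod≤ k) n<K))
... | inj₂ K≤n = begin
  pod≤ (suc k) n
    ≡⟨ pod≤-suc k n ⟩
  ∑ (suc (n / suc k)) (λ j → pod≤-multiplicity k j (n ∸ j * suc k))
    ≡⟨ cong (λ t → ∑ (suc t) (λ j → pod≤-multiplicity k j (n ∸ j * suc k))) (m/n≡1+[m∸n]/n K≤n) ⟩
  pod≤-multiplicity k 0 n ℤ.+ (pod≤-multiplicity k 1 (n ∸ 1 * suc k) ℤ.+
    ∑ ((n ∸ suc k) / suc k) (λ j → pod≤-multiplicity k (2 + j) (n ∸ (2 + j) * suc k)))
    ≡⟨ cong₂ ℤ._+_ (multiplicity-0 k n) (cong₂ ℤ._+_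
         (trans (cong (λ t → pod≤-multiplicity k 1 (n ∸ t)) (ℕ.*-identityˡ (suc k))) (multiplicity-1-odd odd (n ∸ suc k)))
         (∑-zero ((n ∸ suc k) / suc k) (λ j _ → multiplicity-2+-odd odd j (n ∸ (2 + j) * suc k)))) ⟩
  pod≤ k n ℤ.+ (pod≤ k (n ∸ suc k) ℤ.+ 0ℤ)
    ≡⟨ cong (λ t → pod≤ k n ℤ.+ t) (trans (ℤ.+-identityʳ (pod≤ k (n ∸ suc k))) (sym (ℤ.*-identityˡ (pod≤ k (n ∸ suc k))))) ⟩
  pod≤ k n ℤ.+ 1ℤ ℤ.* pod≤ k (n ∸ suc k)
    ≡⟨ cong (λ t → pod≤ k n ℤ.+ 1ℤ ℤ.* t) (shift-≥ (suc k) (pod≤ k) K≤n) ⟨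
  1+q^ (suc k) (pod≤ k) n
    ∎
  where open ≡-Reasoning

-- Partitions that contain the even part k + 1 correspond, on removal of one copy, to all partitions
-- of the smaller number. This is the factor 1 / (1 - q^{k+1}), stated without division.
pod≤-even : ∀ {k} → 2 ∣ suc k → 1-q^ (suc k) (pod≤ (suc k)) ≗ pod≤ k
pod≤-even {k} 2∣K n with ℕ.<-≤-connex n (suc k)
... | inj₁ n<K = trans (factor-≈ -1ℤ (suc k) (pod≤ (suc k)) n<K) (pod≤-suc-≈ k n<K)
... | inj₂ K≤n = begin
  pod≤ (suc k) n ℤ.+ -1ℤ ℤ.* shift (suc k) (pod≤ (suc k)) n
    ≡⟨ cong₂ (λ s t → s ℤ.+ -1ℤ ℤ.* t) recurrence (shift-≥ (suc k) (pod≤ (suc k)) K≤n) ⟩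
  pod≤ k n ℤ.+ pod≤ (suc k) (n ∸ suc k) ℤ.+ -1ℤ ℤ.* pod≤ (suc k) (n ∸ suc k)
    ≡⟨ cancel (pod≤ k n) (pod≤ (suc k) (n ∸ suc k)) ⟩
  pod≤ k n
    ∎
  where
  open ≡-Reasoning
  cancel : ∀ x y → x ℤ.+ y ℤ.+ -1ℤ ℤ.* y ≡ x
  cancel = solve-∀
  recurrence : pod≤ (suc k) n ≡ pod≤ k n ℤ.+ pod≤ (suc k) (n ∸ suc k)
  recurrence = begin
    pod≤ (suc k) n
      ≡⟨ pod≤-suc k n ⟩
    ∑ (suc (n / suc k)) (λ j → pod≤-multiplicity k j (n ∸ j * suc k))
      ≡⟨ cong (λ t → ∑ (suc t) (λ j → pod≤-multiplicity k j (n ∸ j * suc k))) (m/n≡1+[m∸n]/n K≤n) ⟩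
    pod≤-multiplicity k 0 n ℤ.+ ∑ (suc q) (λ j → pod≤-multiplicity k (suc j) (n ∸ suc j * suc k))
      ≡⟨ cong₂ ℤ._+_ (multiplicity-0 k n)
           (∑-cong (suc q) {λ j → pod≤-multiplicity k (suc j) (n ∸ suc j * suc k)}
             {λ j → pod≤-multiplicity k j (n ∸ suc k ∸ j * suc k)} (λ j _ → step j)) ⟩
    pod≤ k n ℤ.+ ∑ (suc q) (λ j → pod≤-multiplicity k j (n ∸ suc k ∸ j * suc k))
      ≡⟨ cong (λ t → pod≤ k n ℤ.+ t) (pod≤-suc k (n ∸ suc k)) ⟨
    pod≤ k n ℤ.+ pod≤ (suc k) (n ∸ suc k)
      ∎
    where
    q = (n ∸ suc k) / suc k
    -- Copies of an even part do not affect distinctness of the odd ones, so both counts depend only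
    -- on what remains, and (n - K) - jK = n - (j + 1)K.
    step : ∀ j → pod≤-multiplicity k (suc j) (n ∸ suc j * suc k) ≡ pod≤-multiplicity k j (n ∸ suc k ∸ j * suc k)
    step j = trans (multiplicity-even 2∣K (suc j) _)
      (trans (cong (pod≤ k) (sym (ℕ.∸-+-assoc n (suc k) (j * suc k)))) (sym (multiplicity-even 2∣K j _)))

2∣double : ∀ n → 2 ∣ double n
2∣double n = divides n (double≡*2 n)
  where
  double≡*2 : ∀ n → double n ≡ n * 2
  double≡*2 zero    = refl
  double≡*2 (suc n) = cong (suc ∘ suc) (double≡*2 n)

odd-suc-double : ∀ n → Odd (suc (double n))
odd-suc-double n 2∣1+2n = contradiction (∣1⇒≡1 (∣m+n∣m⇒∣n (subst (2 ∣_) (ℕ.+-comm 1 (double n)) 2∣1+2n) (2∣double n))) λ ()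

pod≤-0 : pod≤ 0 ≗ 𝟏
pod≤-0 zero    = refl
pod≤-0 (suc n) = refl

-- Euler's pairing and the inverse of ∏ (1 - q^x)

factor-squares : ∀ k f → 1+q^ k (1-q^ k f) ≗ 1-q^ (double k) f
factor-squares k f m = begin
  f m ℤ.+ -1ℤ ℤ.* shift k f m ℤ.+ 1ℤ ℤ.* shift k (1-q^ k f) m
    ≡⟨ cong (λ t → f m ℤ.+ -1ℤ ℤ.* shift k f m ℤ.+ 1ℤ ℤ.* t) (factor-homo (shift-isMultiplier k) -1ℤ k f m) ⟩
  f m ℤ.+ -1ℤ ℤ.* shift k f m ℤ.+ 1ℤ ℤ.* (shift k f m ℤ.+ -1ℤ ℤ.* shift k (shift k f) m)
    ≡⟨ cancel (f m) (shift k f m) (shift k (shift k f) m) ⟩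
  f m ℤ.+ -1ℤ ℤ.* shift k (shift k f) m
    ≡⟨ cong (λ t → f m ℤ.+ -1ℤ ℤ.* t) (trans (shift-+ k k f m) (shift-exp f (sym (double≡+ k)) m)) ⟩
  f m ℤ.+ -1ℤ ℤ.* shift (double k) f m
    ∎
  where
  open ≡-Reasoning
  cancel : ∀ x y z → x ℤ.+ -1ℤ ℤ.* y ℤ.+ 1ℤ ℤ.* (y ℤ.+ -1ℤ ℤ.* z) ≡ x ℤ.+ -1ℤ ℤ.* z
  cancel = solve-∀

∏[1-q²ˣ] : ℕ → Series → Series
∏[1-q²ˣ] = ∏ (1-q^ ∘ double)

∏[1-q²ˣ]-isMultiplier : ∀ N → IsMultiplier (∏[1-q²ˣ] N)
∏[1-q²ˣ]-isMultiplier = ∏-isMultiplier (factor-isMultiplier -1ℤ ∘ double)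

∏[1-q²ˣ]-≈ : ∀ d N f → ∏[1-q²ˣ] (d + N) f ≈[ suc N ] ∏[1-q²ˣ] N f
∏[1-q²ˣ]-≈ zero    N f m<   = refl
∏[1-q²ˣ]-≈ (suc d) N f m<   = trans
  (factor-≈ -1ℤ (double (suc (d + N))) (∏[1-q²ˣ] (d + N) f) (ℕ.≤-trans m< bound))
  (∏[1-q²ˣ]-≈ d N f m<)
  where
  bound : suc N ≤ double (suc (d + N))
  bound = s≤s (ℕ.≤-trans (ℕ.m≤n+m N d) (ℕ.≤-trans (ℕ.m≤m+n (d + N) _) (ℕ.≤-trans (ℕ.≤-reflexive (sym (double≡+ (d + N)))) (ℕ.n≤1+n _))))

qfact-isMultiplier : ∀ c → IsMultiplier (qfact c)
qfact-isMultiplier = ∏-isMultiplier (factor-isMultiplier -1ℤ)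

-- Euler's pairing of (1 - q^x)(1 + q^x) for odd x and (1 - q^{2x})(1 + q^{2x}) for all x.
euler : ∀ N → ∏[1+q²ˣ] N (∏[1-q²ˣ] N (qfact (double N) (pod≤ (double N)))) ≗ ∏[1-q²ˣ] (double N) 𝟏
euler zero    m = pod≤-0 m
euler (suc N) m = begin
  1+q^ e (∏[1+q²ˣ] N (1-q^ e (∏[1-q²ˣ] N (1-q^ e (1-q^ o (qfact (double N) p)))))) m
    ≡⟨ ≗-cong (factor-isMultiplier 1ℤ e) (λ i →
         trans (factor-homo (∏[1+q²ˣ]-isMultiplier N) -1ℤ e _ i)
               (≗-cong (factor-isMultiplier -1ℤ e) odd-factors i)) m ⟩
  1+q^ e (1-q^ e (1-q^ (double o) (∏[1-q²ˣ] (double N) 𝟏))) m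
    ≡⟨ factor-squares e (1-q^ (double o) (∏[1-q²ˣ] (double N) 𝟏)) m ⟩
  1-q^ (double e) (1-q^ (double o) (∏[1-q²ˣ] (double N) 𝟏)) m
    ∎
  where
  open ≡-Reasoning
  e = double (suc N)
  o = suc (double N)
  p = pod≤ (double (suc N))
  H : Series → Series
  H f = ∏[1+q²ˣ] N (∏[1-q²ˣ] N (qfact (double N) f))
  ℋ₂ : IsMultiplier (∏[1+q²ˣ] N ∘ ∏[1-q²ˣ] N)
  ℋ₂ = ∘-isMultiplier (∏[1+q²ˣ]-isMultiplier N) (∏[1-q²ˣ]-isMultiplier N)
  ℋ : IsMultiplier H
  ℋ = ∘-isMultiplier ℋ₂ (qfact-isMultiplier (double N))
  𝒪 = factor-isMultiplier -1ℤ o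
  -- Of the two factors 1 - q^e, the one from `qfact` removes the even part e from `pod≤ e`; what is
  -- left contains 1 + q^o for the odd part o, which pairs with 1 - q^o. The other 1 - q^e is kept
  -- for 1 + q^e.
  odd-factors : ∏[1+q²ˣ] N (∏[1-q²ˣ] N (1-q^ e (1-q^ o (qfact (double N) p)))) ≗ 1-q^ (double o) (∏[1-q²ˣ] (double N) 𝟏)
  odd-factors i = begin
    ∏[1+q²ˣ] N (∏[1-q²ˣ] N (1-q^ e (1-q^ o (qfact (double N) p)))) i
      ≡⟨ ≗-cong ℋ₂ (factor-homo 𝒪 -1ℤ e (qfact (double N) p)) i ⟨
    ∏[1+q²ˣ] N (∏[1-q²ˣ] N (1-q^ o (1-q^ e (qfact (double N) p)))) i
      ≡⟨ factor-homo ℋ₂ -1ℤ o (1-q^ e (qfact (double N) p)) i ⟩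
    1-q^ o (∏[1+q²ˣ] N (∏[1-q²ˣ] N (1-q^ e (qfact (double N) p)))) i
      ≡⟨ ≗-cong 𝒪 (≗-cong ℋ₂ (factor-homo (qfact-isMultiplier (double N)) -1ℤ e p)) i ⟨
    1-q^ o (H (1-q^ e p)) i
      ≡⟨ ≗-cong 𝒪 (≗-cong ℋ (λ j → trans (pod≤-even (2∣double (suc N)) j) (pod≤-odd (odd-suc-double N) j))) i ⟩
    1-q^ o (H (1+q^ o (pod≤ (double N)))) i
      ≡⟨ ≗-cong 𝒪 (factor-homo ℋ 1ℤ o (pod≤ (double N))) i ⟩
    1-q^ o (1+q^ o (H (pod≤ (double N)))) i
      ≡⟨ factor-homo 𝒪 1ℤ o (H (pod≤ (double N))) i ⟩
    1+q^ o (1-q^ o (H (pod≤ (double N)))) i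
      ≡⟨ factor-squares o (H (pod≤ (double N))) i ⟩
    1-q^ (double o) (H (pod≤ (double N))) i
      ≡⟨ ≗-cong (factor-isMultiplier -1ℤ (double o)) (euler N) i ⟩
    1-q^ (double o) (∏[1-q²ˣ] (double N) 𝟏) i
      ∎

-- Modulo q^{N+1} the right side of `euler` keeps only its factors with x ≤ N, exactly the ∏ (1 -
-- q^{2x}) on the left, and this product cancels.
pod-inverse : ∀ N → qfact (double N) (∏[1+q²ˣ] N (pod≤ (double N))) ≈[ suc N ] 𝟏
pod-inverse N = ∏-cancel -1ℤ N {qfact (double N) (∏[1+q²ˣ] N (pod≤ (double N)))} {𝟏} (suc N) λ {m} m< → begin
  ∏[1-q²ˣ] N (qfact (double N) (∏[1+q²ˣ] N (pod≤ (double N)))) m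
    ≡⟨ ≗-cong (∏[1-q²ˣ]-isMultiplier N) (∏-homo (qfact-isMultiplier (double N)) 1ℤ double N (pod≤ (double N))) m ⟩
  ∏[1-q²ˣ] N (∏[1+q²ˣ] N (qfact (double N) (pod≤ (double N)))) m
    ≡⟨ ∏-homo (∏[1-q²ˣ]-isMultiplier N) 1ℤ double N (qfact (double N) (pod≤ (double N))) m ⟩
  ∏[1+q²ˣ] N (∏[1-q²ˣ] N (qfact (double N) (pod≤ (double N)))) m
    ≡⟨ euler N m ⟩
  ∏[1-q²ˣ] (double N) 𝟏 m
    ≡⟨ cong (λ t → ∏[1-q²ˣ] t 𝟏 m) (double≡+ N) ⟩
  ∏[1-q²ˣ] (N + N) 𝟏 m
    ≡⟨ ∏[1-q²ˣ]-≈ N N 𝟏 m< ⟩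
  ∏[1-q²ˣ] N 𝟏 m
    ∎
  where open ≡-Reasoning

-- Signed counts of quadruples

-- The Iverson bracket.
⟦_⟧ : ∀ {P : Set} → Dec P → ℤ
⟦ P? ⟧ = if does P? then 1ℤ else 0ℤ

⟦⟧-× : ∀ {P Q : Set} (P? : Dec P) (Q? : Dec Q) → ⟦ P? ×-dec Q? ⟧ ≡ ⟦ P? ⟧ ℤ.* ⟦ Q? ⟧
⟦⟧-× P? Q? with does P? | does Q?
... | true  | true  = refl
... | true  | false = refl
... | false | true  = refl
... | false | false = refl

⟦⟧-true : ∀ {P : Set} (P? : Dec P) → P → ⟦ P? ⟧ ≡ 1ℤ
⟦⟧-true (yes _) _ = refl
⟦⟧-true (no ¬p) p = contradiction p ¬p

⟦⟧-false : ∀ {P : Set} (P? : Dec P) → ¬ P → ⟦ P? ⟧ ≡ 0ℤ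
⟦⟧-false (yes p) ¬p = contradiction p ¬p
⟦⟧-false (no _)  _  = refl

sumℤ-filter : ∀ {A : Set} {P : A → Set} (P? : Decidable P) (f : A → ℤ) xs →
  sumℤ (map f (filter P? xs)) ≡ sumℤ (map (λ x → ⟦ P? x ⟧ ℤ.* f x) xs)
sumℤ-filter P? f []       = refl
sumℤ-filter P? f (x ∷ xs) with does (P? x)
... | true  = cong₂ ℤ._+_ (sym (ℤ.*-identityˡ (f x))) (sumℤ-filter P? f xs)
... | false = trans (sumℤ-filter P? f xs) (sym (ℤ.+-identityˡ _))

sumℤ-++ : ∀ xs ys → sumℤ (xs ++ ys) ≡ sumℤ xs ℤ.+ sumℤ ys
sumℤ-++ []       ys = sym (ℤ.+-identityˡ _)
sumℤ-++ (x ∷ xs) ys = trans (cong (λ t → x ℤ.+ t) (sumℤ-++ xs ys)) (sym (ℤ.+-assoc x _ _))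

sumℤ-cartesianProduct : ∀ {A B : Set} (f : A × B → ℤ) xs ys →
  sumℤ (map f (cartesianProduct xs ys)) ≡ sumℤ (map (λ x → sumℤ (map (λ y → f (x , y)) ys)) xs)
sumℤ-cartesianProduct f []       ys = refl
sumℤ-cartesianProduct f (x ∷ xs) ys = begin
  sumℤ (map f (map (x ,_) ys ++ cartesianProduct xs ys))
    ≡⟨ cong sumℤ (map-++ f (map (x ,_) ys) (cartesianProduct xs ys)) ⟩
  sumℤ (map f (map (x ,_) ys) ++ map f (cartesianProduct xs ys))
    ≡⟨ sumℤ-++ (map f (map (x ,_) ys)) _ ⟩
  sumℤ (map f (map (x ,_) ys)) ℤ.+ sumℤ (map f (cartesianProduct xs ys))
    ≡⟨ cong₂ ℤ._+_ (cong sumℤ (sym (map-∘ ys))) (sumℤ-cartesianProduct f xs ys) ⟩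
  sumℤ (map (λ y → f (x , y)) ys) ℤ.+ sumℤ (map (λ x → sumℤ (map (λ y → f (x , y)) ys)) xs)
    ∎
  where
  open ≡-Reasoning

sumℤ-applyUpTo : ∀ (f : ℕ → ℤ) (h : ℕ → ℕ) n → sumℤ (map f (applyUpTo h n)) ≡ ∑ n (f ∘ h)
sumℤ-applyUpTo f h zero    = refl
sumℤ-applyUpTo f h (suc n) = cong (λ t → f (h 0) ℤ.+ t) (sumℤ-applyUpTo f (h ∘ suc) n)

sumℤ-upTo : ∀ f n → sumℤ (map f (upTo n)) ≡ ∑ n f
sumℤ-upTo f n = sumℤ-applyUpTo f id n

sumℤ-upTo² : ∀ {B : Set} (f : ℕ × B → ℤ) n ys {g : ℕ → ℤ} →
  (∀ x → sumℤ (map (λ y → f (x , y)) ys) ≡ g x) → sumℤ (map f (cartesianProduct (upTo n) ys)) ≡ ∑ n g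
sumℤ-upTo² f n ys inner = trans (sumℤ-cartesianProduct f (upTo n) ys)
  (trans (sumℤ-upTo _ n) (∑-cong n λ x _ → inner x))

∑-restrict : ∀ {y n} → y ≤ n → ∀ {h g} → (∀ x → x < y → h x ≡ g x) → (∀ x → y ≤ x → h x ≡ 0ℤ) → ∑ n h ≡ ∑ y g
∑-restrict {n = n} z≤n       below above = ∑-zero n (λ x _ → above x z≤n)
∑-restrict         (s≤s y≤n) below above = cong₂ ℤ._+_ (below 0 (s≤s z≤n))
  (∑-restrict y≤n (λ x x<y → below (suc x) (s≤s x<y)) (λ x y≤x → above (suc x) (s≤s y≤x)))

shift-𝟏 : ∀ k n → shift k 𝟏 n ≡ ⟦ k ℕ.≟ n ⟧
shift-𝟏 zero    zero    = refl
shift-𝟏 zero    (suc n) = refl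
shift-𝟏 (suc k) zero    = refl
shift-𝟏 (suc k) (suc n) = shift-𝟏 k n

module _ (n : ℕ) where

  private
    weight : ℕ → ℕ → ℕ → ℕ → ℤ
    weight x y r₁ r₂ = ⟦ (2 * r₁ + 1) * x + (2 * r₂ + 1) * y ℕ.≟ n ⟧ ℤ.* -1ℤ ℤ.^ (r₁ + r₂)

    term : ℕ → ℕ → ℕ → ℕ → ℤ
    term x y r₁ r₂ = ⟦ admissible? n (x , y , r₁ , r₂) ⟧ ℤ.* -1ℤ ℤ.^ (r₁ + r₂)

    ∑∑ : (ℕ → ℕ → ℤ) → ℤ
    ∑∑ f = ∑ (suc n) (λ r₁ → ∑ (suc n) (f r₁))

    ∑∑-cong : ∀ {f g} → (∀ r₁ r₂ → f r₁ r₂ ≡ g r₁ r₂) → ∑∑ f ≡ ∑∑ g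
    ∑∑-cong {f} {g} f≡g = ∑-cong (suc n) {λ r₁ → ∑ (suc n) (f r₁)} {λ r₁ → ∑ (suc n) (g r₁)}
      (λ r₁ _ → ∑-cong (suc n) {f r₁} {g r₁} (λ r₂ _ → f≡g r₁ r₂))

    ∑∑-zero : ∀ {f} → (∀ r₁ r₂ → f r₁ r₂ ≡ 0ℤ) → ∑∑ f ≡ 0ℤ
    ∑∑-zero {f} f≡0 = ∑-zero (suc n) {λ r₁ → ∑ (suc n) (f r₁)} (λ r₁ _ → ∑-zero (suc n) {f r₁} (λ r₂ _ → f≡0 r₁ r₂))

    term-inadmissible : ∀ x y r₁ r₂ → ¬ (1 ≤ x × x < y) → term x y r₁ r₂ ≡ 0ℤ
    term-inadmissible x y r₁ r₂ ¬xy = cong (ℤ._* -1ℤ ℤ.^ (r₁ + r₂))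
      (⟦⟧-false (admissible? n (x , y , r₁ , r₂)) (λ (1≤x , x<y , _) → ¬xy (1≤x , x<y)))

    term-admissible : ∀ x y r₁ r₂ → 1 ≤ x → x < y → term x y r₁ r₂ ≡ weight x y r₁ r₂
    term-admissible x y r₁ r₂ 1≤x x<y = cong (ℤ._* -1ℤ ℤ.^ (r₁ + r₂)) (begin
      ⟦ admissible? n (x , y , r₁ , r₂) ⟧                  ≡⟨ ⟦⟧-× (1 ℕ.≤? x) ((x ℕ.<? y) ×-dec eq?) ⟩
      ⟦ 1 ℕ.≤? x ⟧ ℤ.* ⟦ (x ℕ.<? y) ×-dec eq? ⟧            ≡⟨ cong₂ ℤ._*_ (⟦⟧-true (1 ℕ.≤? x) 1≤x) (⟦⟧-× (x ℕ.<? y) eq?) ⟩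
      1ℤ ℤ.* (⟦ x ℕ.<? y ⟧ ℤ.* ⟦ eq? ⟧)                    ≡⟨ cong (λ t → 1ℤ ℤ.* (t ℤ.* ⟦ eq? ⟧)) (⟦⟧-true (x ℕ.<? y) x<y) ⟩
      1ℤ ℤ.* (1ℤ ℤ.* ⟦ eq? ⟧)                              ≡⟨ trans (ℤ.*-identityˡ _) (ℤ.*-identityˡ _) ⟩
      ⟦ eq? ⟧                                              ∎)
      where
      open ≡-Reasoning
      eq? = (2 * r₁ + 1) * x + (2 * r₂ + 1) * y ℕ.≟ n

  -- The larger part is moved outermost, as in `elementary`, where the outer index bounds all the
  -- inner ones.
  a≡∑ : a n ≡ ∑ n (λ y → ∑ y (λ x → ∑∑ (weight (suc x) (suc y))))
  a≡∑ = begin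
    a n
      ≡⟨ sumℤ-filter (admissible? n) sign (box n) ⟩
    sumℤ (map (λ q → ⟦ admissible? n q ⟧ ℤ.* sign q) (box n))
      ≡⟨ sumℤ-upTo² (λ (x , y , r₁ , r₂) → term x y r₁ r₂) (suc n) (cartesianProduct I (cartesianProduct I I)) (λ x →
           sumℤ-upTo² (λ (y , r₁ , r₂) → term x y r₁ r₂) (suc n) (cartesianProduct I I) (λ y →
             sumℤ-upTo² (λ (r₁ , r₂) → term x y r₁ r₂) (suc n) I (λ r₁ → sumℤ-upTo (term x y r₁) (suc n)))) ⟩
    ∑ (suc n) (λ x → ∑ (suc n) (λ y → ∑∑ (term x y)))
      ≡⟨ cong₂ ℤ._+_
           (∑-zero (suc n) {λ y → ∑∑ (term 0 y)} (λ y _ → ∑∑-zero {term 0 y} (λ r₁ r₂ → term-inadmissible 0 y r₁ r₂ (λ ()))))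
           (∑-cong n {λ x → ∑ (suc n) (λ y → ∑∑ (term (suc x) y))} {λ x → ∑ n (λ y → ∑∑ (term (suc x) (suc y)))}
              (λ x _ → trans (cong (ℤ._+ ∑ n (λ y → ∑∑ (term (suc x) (suc y)))) (∑∑-zero {term (suc x) 0} (λ r₁ r₂ → term-inadmissible (suc x) 0 r₁ r₂ (λ ())))) (ℤ.+-identityˡ _))) ⟩
    0ℤ ℤ.+ ∑ n (λ x → ∑ n (λ y → ∑∑ (term (suc x) (suc y))))
      ≡⟨ ℤ.+-identityˡ _ ⟩
    ∑ n (λ x → ∑ n (λ y → ∑∑ (term (suc x) (suc y))))
      ≡⟨ ∑-comm n n (λ x y → ∑∑ (term (suc x) (suc y))) ⟩
    ∑ n (λ y → ∑ n (λ x → ∑∑ (term (suc x) (suc y))))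
      ≡⟨ ∑-cong n (λ y y<n → ∑-restrict (ℕ.<⇒≤ y<n)
           (λ x x<y → ∑∑-cong (λ r₁ r₂ → term-admissible (suc x) (suc y) r₁ r₂ (s≤s z≤n) (s≤s x<y)))
           (λ x y≤x → ∑∑-zero {term (suc x) (suc y)} (λ r₁ r₂ → term-inadmissible (suc x) (suc y) r₁ r₂ (λ (_ , x<y) → ℕ.<⇒≱ (s≤s⁻¹ x<y) y≤x)))) ⟩
    ∑ n (λ y → ∑ y (λ x → ∑∑ (weight (suc x) (suc y))))
      ∎
    where
    open ≡-Reasoning
    I = upTo (suc n)

  private
    weight-shift : ∀ x y r₁ r₂ →
      -1ℤ ℤ.^ r₂ ℤ.* (-1ℤ ℤ.^ r₁ ℤ.* shift ((2 * r₂ + 1) * y) (shift ((2 * r₁ + 1) * x) 𝟏) n) ≡ weight x y r₁ r₂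
    weight-shift x y r₁ r₂ = begin
      s₂ ℤ.* (s₁ ℤ.* shift ((2 * r₂ + 1) * y) (shift ((2 * r₁ + 1) * x) 𝟏) n)
        ≡⟨ cong (λ t → s₂ ℤ.* (s₁ ℤ.* t)) (trans (shift-+ y′ x′ 𝟏 n) (trans (shift-exp 𝟏 (ℕ.+-comm y′ x′) n) (shift-𝟏 (x′ + y′) n))) ⟩
      s₂ ℤ.* (s₁ ℤ.* δ)
        ≡⟨ regroup s₁ s₂ δ ⟩
      δ ℤ.* (s₁ ℤ.* s₂)
        ≡⟨ cong (δ ℤ.*_) (ℤ.^-distribˡ-+-* -1ℤ r₁ r₂) ⟨
      weight x y r₁ r₂
        ∎
      where
      open ≡-Reasoning
      s₁ = -1ℤ ℤ.^ r₁
      s₂ = -1ℤ ℤ.^ r₂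
      x′ = (2 * r₁ + 1) * x
      y′ = (2 * r₂ + 1) * y
      δ = ⟦ x′ + y′ ℕ.≟ n ⟧
      regroup : ∀ s t d → t ℤ.* (s ℤ.* d) ≡ d ℤ.* (s ℤ.* t)
      regroup = solve-∀

    row : ∀ y → odd-multiples (suc n) (suc y) (elementary (suc n) 1 y) n ≡ ∑ y (λ x → ∑∑ (weight (suc x) (suc y)))
    row y = begin
      ∑ (suc n) (λ r₂ → -1ℤ ℤ.^ r₂ ℤ.* shift ((2 * r₂ + 1) * suc y) (elementary (suc n) 1 y) n)
        ≡⟨ ∑-cong (suc n) {λ r₂ → -1ℤ ℤ.^ r₂ ℤ.* shift ((2 * r₂ + 1) * suc y) (elementary (suc n) 1 y) n}
             {λ r₂ → ∑ y (λ x → ∑ (suc n) (λ r₁ → w x r₁ r₂))} (λ r₂ _ → expand r₂) ⟩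
      ∑ (suc n) (λ r₂ → ∑ y (λ x → ∑ (suc n) (λ r₁ → w x r₁ r₂)))
        ≡⟨ ∑-comm (suc n) y (λ r₂ x → ∑ (suc n) (λ r₁ → w x r₁ r₂)) ⟩
      ∑ y (λ x → ∑ (suc n) (λ r₂ → ∑ (suc n) (λ r₁ → w x r₁ r₂)))
        ≡⟨ ∑-cong y (λ x _ → ∑-comm (suc n) (suc n) (λ r₂ r₁ → w x r₁ r₂)) ⟩
      ∑ y (λ x → ∑∑ (w x))
        ∎
      where
      open ≡-Reasoning
      w : ℕ → ℕ → ℕ → ℤ
      w x = weight (suc x) (suc y)
      u : ℕ → ℕ → Series
      u x r₁ = -1ℤ ℤ.^ r₁ · shift ((2 * r₁ + 1) * suc x) 𝟏
      expand : ∀ r₂ → -1ℤ ℤ.^ r₂ ℤ.* shift ((2 * r₂ + 1) * suc y) (elementary (suc n) 1 y) n ≡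
                      ∑ y (λ x → ∑ (suc n) (λ r₁ → w x r₁ r₂))
      expand r₂ = begin
        s ℤ.* L (elementary (suc n) 1 y) n
          ≡⟨ cong (s ℤ.*_) (∑-homo ℒ y (λ x m → ∑ (suc n) (λ r₁ → u x r₁ m)) n) ⟩
        s ℤ.* ∑ y (λ x → L (λ m → ∑ (suc n) (λ r₁ → u x r₁ m)) n)
          ≡⟨ *-distribˡ-∑ y s _ ⟩
        ∑ y (λ x → s ℤ.* L (λ m → ∑ (suc n) (λ r₁ → u x r₁ m)) n)
          ≡⟨ ∑-cong y (λ x _ → trans (cong (s ℤ.*_) (∑-homo ℒ (suc n) (u x) n)) (*-distribˡ-∑ (suc n) s (λ r₁ → L (u x r₁) n))) ⟩
        ∑ y (λ x → ∑ (suc n) (λ r₁ → s ℤ.* L (u x r₁) n))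
          ≡⟨ ∑-cong y (λ x _ → ∑-cong (suc n) {λ r₁ → s ℤ.* L (u x r₁) n} {λ r₁ → w x r₁ r₂} (λ r₁ _ →
               trans (cong (s ℤ.*_) (·-homo ℒ (-1ℤ ℤ.^ r₁) (shift ((2 * r₁ + 1) * suc x) 𝟏) n)) (weight-shift (suc x) (suc y) r₁ r₂))) ⟩
        ∑ y (λ x → ∑ (suc n) (λ r₁ → w x r₁ r₂))
          ∎
        where
        s = -1ℤ ℤ.^ r₂
        L = shift ((2 * r₂ + 1) * suc y)
        ℒ = shift-isMultiplier ((2 * r₂ + 1) * suc y)

  -- With B = n + 1 the cut geometric series run over the same r₁, r₂ ≤ n as `box n`, so the
  -- equality is exact and needs no estimate of remainders.
  a≡elementary : a n ≡ elementary (suc n) 2 n n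
  a≡elementary = trans a≡∑ (sym (∑-cong n (λ y _ → row y)))

-- From the triple product to pod

-- The binomial is controlled modulo q^{N-k+1}, and the shift by T_k ≥ k lifts this to q^{N+1}. For
-- k > N both sides vanish in this range, again since T_k ≥ k.
layer-pod : ∀ N k → layer N k 𝟏 ≈[ suc N ] ∏[1+q²ˣ] N (shift (T k) (pod≤ (double N)))
layer-pod N k {m} m<1+N with ℕ.<-≤-connex N k
... | inj₁ N<k = trans (layer-> N k 𝟏 N<k m) (sym (trans (shift-homo (∏[1+q²ˣ]-isMultiplier N) (T k) (pod≤ (double N)) m)
  (shift-< (T k) (∏[1+q²ˣ] N (pod≤ (double N))) (ℕ.≤-trans m<1+N (ℕ.≤-trans N<k (n≤Tn k))))))
... | inj₂ k≤N = begin
  layer N k 𝟏 m                                      ≡⟨ layer-gauss N k (suc α) 𝟏 (cong suc (ℕ.m∸n+n≡m k≤N)) m ⟩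
  shift (T k) (gauss (suc α) (suc (N + k)) 𝟏) m      ≡⟨ shift-≈ (T k) {gauss (suc α) (suc (N + k)) 𝟏} {κ} (suc α) gauss≈κ m<Tk+1+α ⟩
  shift (T k) κ m                                    ≡⟨ shift-homo (∏[1+q²ˣ]-isMultiplier N) (T k) (pod≤ (double N)) m ⟨
  ∏[1+q²ˣ] N (shift (T k) (pod≤ (double N))) m       ∎
  where
  open ≡-Reasoning
  α = N ∸ k
  κ = ∏[1+q²ˣ] N (pod≤ (double N))
  α≤2N : α ≤ double N
  α≤2N = ℕ.≤-trans (ℕ.m∸n≤m N k) (ℕ.≤-trans (ℕ.m≤m+n N N) (ℕ.≤-reflexive (sym (double≡+ N))))
  -- The series 1 is replaced by `qfact (double N) κ`, and the binomial then absorbs the `qfact`.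
  gauss≈κ : gauss (suc α) (suc (N + k)) 𝟏 ≈[ suc α ] κ
  gauss≈κ {i} i<1+α = begin
    gauss (suc α) (suc (N + k)) 𝟏 i
      ≡⟨ ≈-cong (gauss-isMultiplier (suc α) (suc (N + k))) {qfact (double N) κ} {𝟏} (suc N) (pod-inverse N) (ℕ.≤-trans i<1+α (s≤s (ℕ.m∸n≤m N k))) ⟨
    gauss (suc α) (suc (N + k)) (qfact (double N) κ) i
      ≡⟨ cong (λ c → gauss (suc α) (suc (N + k)) (qfact c κ) i) (ℕ.m∸n+n≡m α≤2N) ⟨
    gauss (suc α) (suc (N + k)) (qfact (double N ∸ α + α) κ) i
      ≡⟨ gauss-qfact α (suc (N + k)) (double N ∸ α) κ (ℕ.≤-trans (ℕ.m∸n≤m N k) (ℕ.≤-trans (ℕ.m≤m+n N k) (ℕ.n≤1+n _))) i<1+α ⟩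
    κ i
      ∎
  m<Tk+1+α : m < T k + suc α
  m<Tk+1+α = ℕ.≤-trans m<1+N (ℕ.≤-trans (ℕ.≤-reflexive (trans (cong suc (sym (ℕ.m+[n∸m]≡n k≤N))) (sym (ℕ.+-suc k α)))) (ℕ.+-monoˡ-≤ (suc α) (n≤Tn k)))

podSum : ℕ → ℕ → Series
podSum N L m = ∑ (suc L) (λ k → chebyshev 2 k ℤ.* shift (T k) (pod≤ (double N)) m)

-- `layer-pod` leaves ∏ (1 + q^{2x}) in front of every summand, the very product that clears the
-- denominators of e_2, so it can be cancelled on both sides.
elementary≈podSum : ∀ N L → N ≤ L → elementary (suc N) 2 N ≈[ suc N ] podSum N L
elementary≈podSum N L N≤L = ∏-cancel 1ℤ N {elementary (suc N) 2 N} {podSum N L} (suc N) λ {m} m<1+N → begin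
  ∏[1+q²ˣ] N (elementary (suc N) 2 N) m
    ≡⟨ elementary-theta (suc N) 2 N L N≤L m<1+N ⟩
  ∑ (suc L) (λ k → chebyshev 2 k ℤ.* layer N k 𝟏 m)
    ≡⟨ ∑-cong (suc L) {λ k → chebyshev 2 k ℤ.* layer N k 𝟏 m} {λ k → ∏[1+q²ˣ] N (summand k) m} (λ k _ →
         trans (cong (chebyshev 2 k ℤ.*_) (layer-pod N k m<1+N)) (sym (·-homo 𝒦 (chebyshev 2 k) (shift (T k) (pod≤ (double N))) m))) ⟩
  ∑ (suc L) (λ k → ∏[1+q²ˣ] N (summand k) m)
    ≡⟨ ∑-homo 𝒦 (suc L) summand m ⟨
  ∏[1+q²ˣ] N (podSum N L) m
    ∎
  where
  open ≡-Reasoning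
  𝒦 = ∏[1+q²ˣ]-isMultiplier N
  summand : ℕ → Series
  summand k = chebyshev 2 k · shift (T k) (pod≤ (double N))

shift-pod : ∀ n t → shift t (pod≤ (double n)) n ≡ + podℤ (+ n ℤ.- + t)
shift-pod n t with ℕ.<-≤-connex n t
-- Positivity of `t ∸ n` exposes a successor, so its negation has the form `-[1+_]`, on which `podℤ`
-- is 0.
... | inj₁ n<t rewrite ℤ.m-n≡m⊖n n t | ℤ.⊖-< n<t with t ∸ n | ℕ.m<n⇒0<n∸m n<t
...   | suc _ | _ = shift-< t (pod≤ (double n)) n<t
shift-pod n t | inj₂ t≤n = begin
  shift t (pod≤ (double n)) n                         ≡⟨ shift-≥ t (pod≤ (double n)) t≤n ⟩
  pod≤ (double n) (n ∸ t)                             ≡⟨ cong (λ c → pod≤ c (n ∸ t)) (ℕ.m∸n+n≡m n∸t≤2n) ⟨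
  pod≤ (double n ∸ (n ∸ t) + (n ∸ t)) (n ∸ t)         ≡⟨ pod≤-stable (double n ∸ (n ∸ t)) (n ∸ t) ⟩
  + pod (n ∸ t)                                       ≡⟨ cong (+_ ∘ podℤ) (trans (ℤ.m-n≡m⊖n n t) (ℤ.⊖-≥ t≤n)) ⟨
  + podℤ (+ n ℤ.- + t)                                ∎
  where
  open ≡-Reasoning
  n∸t≤2n : n ∸ t ≤ double n
  n∸t≤2n = ℕ.≤-trans (ℕ.m∸n≤m n t) (ℕ.≤-trans (ℕ.m≤m+n n n) (ℕ.≤-reflexive (sym (double≡+ n))))

corollary1p4 : (n : ℕ) → 1 ≤ n →
    Σ[1≤r<∞] (λ r → -1ℤ ℤ.^ T (r ∸ 1) ℤ.* + T ⌈ r /2⌉ ℤ.* + podℤ (+ n ℤ.- + T (r + 1))) ≐ a n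
-- The series is stationary from n on: for r > n already T_{r+1} > n, so `podℤ` vanishes.
corollary1p4 n _ = n , λ M n≤M → begin
  sumℤ (map (λ i → summand (suc i)) (upTo M))
    ≡⟨ sumℤ-upTo (summand ∘ suc) M ⟩
  ∑ M (summand ∘ suc)
    ≡⟨ ∑-cong M {summand ∘ suc} (λ i _ → summand-suc i) ⟩
  ∑ M (λ i → chebyshev 2 (2 + i) ℤ.* shift (T (2 + i)) (pod≤ (double n)) n)
    -- V_0 and V_1 have no z² term, so the first two summands of `podSum` are zero and V_{r+1} pairs
    -- with r ≥ 1.
    ≡⟨ trans (ℤ.+-identityˡ _) (ℤ.+-identityˡ _) ⟨
  podSum n (suc M) n
    ≡⟨ elementary≈podSum n (suc M) (ℕ.m≤n⇒m≤1+n n≤M) ℕ.≤-refl ⟨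
  elementary (suc n) 2 n n
    ≡⟨ a≡elementary n ⟨
  a n
    ∎
  where
  open ≡-Reasoning
  summand : ℕ → ℤ
  summand r = -1ℤ ℤ.^ T (r ∸ 1) ℤ.* + T ⌈ r /2⌉ ℤ.* + podℤ (+ n ℤ.- + T (r + 1))
  summand-suc : ∀ i → summand (suc i) ≡ chebyshev 2 (2 + i) ℤ.* shift (T (2 + i)) (pod≤ (double n)) n
  summand-suc i = cong₂ ℤ._*_ (sym (chebyshev₂-closed i))
    (trans (cong (λ t → + podℤ (+ n ℤ.- + T (suc t))) (ℕ.+-comm i 1)) (sym (shift-pod n (T (2 + i)))))
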